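{- Let $m\ge 1$ be an integer. The cycle index $\mathcal{Z}=\mathcal{Z}_{(\mathcal{U}_{2^m},\mathbb{Z}_{2^m})}$ of the permutation group $\mathcal{U}_{2^m}$ acting on $\mathbb{Z}_{2^m}$ is as follows: - $\mathcal{Z}=x_1^2$ if $m=1$; - $\mathcal{Z}=\frac12\left(x_1^4+x_1^2x_2\right)$ if $m=2$; - $\mathcal{Z}=\frac{1}{2^{m-1}}\left(\mathcal{Z}_1+\mathcal{Z}_2\right)$ if $m\ge 3$, where $$\mathcal{Z}_1=x_1^{2^m}+2^{m-3}x_1^2x_2\prod_{l=3}^m x_{2^{l-2}}^2+\sum_{t=0}^{m-4}2^t x_1^{2^{m-1-t}}\prod_{i=0}^t x_{2^{i+1}}^{2^{m-2-t}},$$ $$\mathcal{Z}_2=x_1^2x_2^{2^m-2}+2^{m-3}x_1^4\prod_{l=3}^m x_{2^{l-2}}^2+x_1^2\sum_{t=0}^{m-4}2^t x_2^{2^{m-t-1}-1}\prod_{i=1}^t x_{2^{i+1}}^{2^{m-t-2}}.$$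
   Context: $\mathbb{Z}_n$ is the set of residues modulo $n$. $\mathcal{U}_n=\mathrm{Aut}(\mathbb{Z}_n)$ is identified with the set of residues $a$ modulo $n$ with $\gcd(a,n)=1$, where $a$ corresponds to the map $\pi_a(x)=ax \pmod n$; it acts on the $n$ points of $\mathbb{Z}_n$ by multiplication. For a permutation $\pi$ of a finite set with $N$ elements, $\mathrm{ctype}(\pi)=\prod_{i=1}^N x_i^{\lambda_i(\pi)}$, where $x_1,x_2,\dots$ are formal indeterminates and $\lambda_i(\pi)$ is the number of cycles of length $i$ (fixed points counted as cycles of length 1) in the disjoint cycle decomposition of $\pi$. The cycle index of a finite permutation group $G$ on a finite set $P$ is $\mathcal{Z}_{(G,P)}=\frac{1}{|G|}\sum_{\pi\in G}\mathrm{ctype}(\pi)$. Empty sums are $0$ and empty products are $1$.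
   Formalization: The first term of Z_2, printed as x_1^2 x_2^{2^m-2}, is corrected to x_1^2 x_2^{2^{m-1}-1}, the cycle type of j -> -j; the printed exponent makes the claim false for every m >= 3 (wrong weighted degree, e.g. x_2^6 instead of x_2^3 for m=3). -}

module Defs where

open import Algebra.Bundles.Raw using (RawSemiring)
import Algebra.Definitions.RawSemiring as RawSemiringDefinitions
open import Data.Bool.Properties using () renaming (_≟_ to _≟ᵇ_)
open import Data.Empty using (⊥-elim)
open import Data.Fin.Base using (Fin; toℕ)
open import Data.Fin.Permutation
  using (Permutation′; permutation; _⟨$⟩ʳ_; _⟨$⟩ˡ_; inverseʳ; _≈_; _∘ₚ_; flip; id)
open import Data.Fin.Properties using (toℕ-injective; toℕ-fromℕ<; toℕ<n)
open import Data.Fin.Subset using (Subset; ⁅_⁆; ⋃; ∣_∣)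
open import Data.Integer.Base as ℤ using (1ℤ)
open import Data.List.Base
  using (List; []; _∷_; _++_; map; foldr; filter; length; concatMap; applyUpTo; iterate;
         deduplicate; allFin; mapMaybe)
open import Data.List.Membership.Propositional using (_∈_; lose)
open import Data.List.Membership.Propositional.Properties using (∈-allFin; ∈-∃++)
open import Data.List.Membership.DecPropositional using () renaming (_∈?_ to mem?)
open import Data.List.Relation.Binary.Permutation.Propositional
  using (_↭_; ↭-refl; ↭-sym; ↭-trans; prep)
open import Data.List.Relation.Binary.Permutation.Propositional.Properties
  using (¬x∷xs↭[]; ∈-resp-↭; drop-∷; shift)
open import Data.List.Relation.Unary.All as All using ([]; _∷_)
open import Data.List.Relation.Unary.All.Properties using (mapMaybe⁺; map⁺)
open import Data.List.Relation.Unary.AllPairs using (AllPairs; []; _∷_)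
open import Data.List.Relation.Unary.Any as Any using (Any; here)
import Data.List.Relation.Unary.Any.Properties as Any
open import Data.List.Relation.Unary.Unique.Propositional using (Unique)
open import Data.List.Relation.Unary.Unique.Propositional.Properties using (allFin⁺)
open import Data.Maybe.Base as Maybe using (Maybe; just; nothing)
open import Data.Maybe.Relation.Unary.All as MAll using (just; nothing)
open import Data.Maybe.Relation.Unary.Any as MAny using (just)
open import Data.Nat.Base using (ℕ; suc; _+_; _*_; _∸_; _^_; pred; NonZero)
open import Data.Nat.Coprimality using (Coprime; coprime?; coprime-Bézout)
open import Data.Nat.Divisibility using (_∣_; ∣-trans; ∣1⇒≡1; m∣m*n; %-presˡ-∣; ∣n∣m%n⇒∣m)
open import Data.Nat.DivMod
  using (_%_; _mod_; %-distribˡ-*; m<n⇒m%n≡m; [m+kn]%n≡m%n; m%n<n)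
open import Data.Nat.GCD using (module Bézout)
open import Data.Nat.Properties using (_≟_; m^n≢0; *-assoc; *-comm; *-identityˡ; suc-pred)
open import Data.Nat.Tactic.RingSolver using (solve-∀)
open import Data.Product.Base using (Σ; ∃; _×_; _,_; proj₁; proj₂)
open import Data.Rational.Base using (ℚ; 0ℚ; 1ℚ; _/_) renaming (_+_ to _+ℚ_; _*_ to _*ℚ_)
open import Data.Vec.Properties using (≡-dec)
open import Level using (0ℓ)
open import Relation.Binary.Definitions using (Decidable)
open import Relation.Binary.PropositionalEquality
open import Relation.Nullary using (¬_; yes; no)

------------------------------------------------------------------------
-- The polynomial ring ℚ[x₀, x₁, x₂, …]

-- A monomial is the multiset of its variable indices: x₁² x₂ is
-- 1 ∷ 1 ∷ 2 ∷ [], and two lists denote the same monomial iff u ↭ v.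

Monomial : Set
Monomial = List ℕ

_≟ᵐ_ : Decidable {A = Monomial} _↭_
[]      ≟ᵐ []      = yes ↭-refl
[]      ≟ᵐ (_ ∷ _) = no λ p → ¬x∷xs↭[] (↭-sym p)
(i ∷ u) ≟ᵐ v with mem? _≟_ i v
... | no i∉v = no λ p → i∉v (∈-resp-↭ p (here refl))
... | yes i∈v with ∈-∃++ i∈v
...   | v₁ , v₂ , refl with u ≟ᵐ (v₁ ++ v₂)
...     | yes p = yes (↭-trans (prep i p) (↭-sym (shift i v₁ v₂)))
...     | no ¬p = no λ p → ¬p (drop-∷ (↭-trans p (shift i v₁ v₂)))

-- A polynomial is a formal sum of terms; the same monomial may occur in
-- several terms, so polynomials are compared by _≈ₚ_ and not by _≡_.

Poly : Set
Poly = List (ℚ × Monomial)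

coeff : Poly → Monomial → ℚ
coeff []            u = 0ℚ
coeff ((c , v) ∷ p) u with v ≟ᵐ u
... | yes _ = c +ℚ coeff p u
... | no  _ = coeff p u

infix 4 _≈ₚ_
_≈ₚ_ : Poly → Poly → Set
p ≈ₚ q = ∀ u → coeff p u ≡ coeff q u

const : ℚ → Poly
const c = (c , []) ∷ []

nat : ℕ → Poly
nat k = const (ℤ.+ k / 1)

x : ℕ → Poly
x i = (1ℚ , i ∷ []) ∷ []

infixl 6 _+ₚ_
_+ₚ_ : Poly → Poly → Poly
_+ₚ_ = _++_

infixl 7 _*ₚ_
_*ₚ_ : Poly → Poly → Poly
p *ₚ q = concatMap (λ (c , u) → map (λ (d , v) → (c *ℚ d , u ++ v)) q) p

polyRawSemiring : RawSemiring 0ℓ 0ℓ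
polyRawSemiring = record
  { Carrier = Poly ; _≈_ = _≈ₚ_
  ; _+_ = _+ₚ_ ; _*_ = _*ₚ_ ; 0# = [] ; 1# = const 1ℚ }

open RawSemiringDefinitions polyRawSemiring public using () renaming (_^_ to _^ₚ_)

sumOver productOver : ∀ {A : Set} → List A → (A → Poly) → Poly
sumOver     is f = foldr _+ₚ_ []         (map f is)
productOver is f = foldr _*ₚ_ (const 1ℚ) (map f is)

infix 6 sumOver
syntax sumOver is (λ i → e) = ∑[ i ∈ is ] e
infix 7 productOver
syntax productOver is (λ i → e) = ∏[ i ∈ is ] e

-- The integers i with a ≤ i < b. The upper end is excluded so that a
-- range such as 0 ≤ t ≤ m - 4 is empty at m = 3, which it would not be
-- with a truncated subtraction as its last element.

[_⋯<_] : ℕ → ℕ → List ℕ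
[ a ⋯< b ] = applyUpTo (a +_) (b ∸ a)

------------------------------------------------------------------------
-- Cycle type

-- All powers πᵏ j of π occur among those with k < N.

cycleOf : ∀ {N} → Permutation′ N → Fin N → Subset N
cycleOf {N} π j = ⋃ (map ⁅_⁆ (iterate (π ⟨$⟩ʳ_) j N))

cycles : ∀ {N} → Permutation′ N → List (Subset N)
cycles {N} π = deduplicate (≡-dec _≟ᵇ_) (map (cycleOf π) (allFin N))

cycleCount : ∀ {N} → Permutation′ N → ℕ → ℕ
cycleCount π i = length (filter (λ c → ∣ c ∣ ≟ i) (cycles π))

ctype : ∀ {N} → Permutation′ N → Poly
ctype {N} π = ∏[ i ∈ [ 1 ⋯< suc N ] ] x i ^ₚ cycleCount π i

------------------------------------------------------------------------
-- Permutation groups and their cycle index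

-- A subgroup of the symmetric group, given by a list without repetition
-- of its elements. Permutations are compared pointwise.

record PermutationGroup (N : ℕ) : Set where
  field
    elements  : List (Permutation′ N)
    distinct  : AllPairs (λ π ρ → ¬ π ≈ ρ) elements
    id-closed : Any (id ≈_) elements
    ∘-closed  : ∀ {π ρ} → π ∈ elements → ρ ∈ elements → Any (π ∘ₚ ρ ≈_) elements
    ⁻¹-closed : ∀ {π} → π ∈ elements → Any (flip π ≈_) elements

  order : ℕ
  order = length elements

  instance
    order-nonZero : NonZero order
    order-nonZero with elements | id-closed
    ... | _ ∷ _ | _ = _

cycleIndex : ∀ {N} → PermutationGroup N → Poly
cycleIndex G = const (1ℤ / order) *ₚ (∑[ π ∈ elements ] ctype π)
  where open PermutationGroup G

------------------------------------------------------------------------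
-- The group of units acting on the residues modulo n

module _ (n : ℕ) .{{_ : NonZero n}} where

  infixl 7 _·_
  _·_ : Fin n → Fin n → Fin n
  a · b = (toℕ a * toℕ b) mod n

  1ᵣ : Fin n
  1ᵣ = 1 mod n

  toℕ-mod : ∀ k → toℕ (k mod n) ≡ k % n
  toℕ-mod k = toℕ-fromℕ< (m%n<n k n)

  mod-cong : ∀ {j k} → j % n ≡ k % n → j mod n ≡ k mod n
  mod-cong {j} {k} eq = toℕ-injective (trans (toℕ-mod j) (trans eq (sym (toℕ-mod k))))

  toℕ-% : ∀ (a : Fin n) → toℕ a % n ≡ toℕ a
  toℕ-% a = m<n⇒m%n≡m (toℕ<n a)

  mod-toℕ : ∀ (a : Fin n) → toℕ a mod n ≡ a
  mod-toℕ a = toℕ-injective (trans (toℕ-mod (toℕ a)) (toℕ-% a))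

  mod-·-mod : ∀ j k → (j mod n) · (k mod n) ≡ (j * k) mod n
  mod-·-mod j k = mod-cong (begin
    toℕ (j mod n) * toℕ (k mod n) % n ≡⟨ cong (_% n) (cong₂ _*_ (toℕ-mod j) (toℕ-mod k)) ⟩
    (j % n) * (k % n) % n             ≡⟨ %-distribˡ-* j k n ⟨
    j * k % n                         ∎)
    where open ≡-Reasoning

  ·-assoc : ∀ a b c → (a · b) · c ≡ a · (b · c)
  ·-assoc a b c = begin
    (a · b) · c                        ≡⟨ cong ((a · b) ·_) (mod-toℕ c) ⟨
    (a · b) · (toℕ c mod n)            ≡⟨ mod-·-mod _ _ ⟩
    (toℕ a * toℕ b * toℕ c) mod n      ≡⟨ cong (_mod n) (*-assoc (toℕ a) _ _) ⟩
    (toℕ a * (toℕ b * toℕ c)) mod n    ≡⟨ mod-·-mod _ _ ⟨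
    (toℕ a mod n) · (b · c)            ≡⟨ cong (_· (b · c)) (mod-toℕ a) ⟩
    a · (b · c)                        ∎
    where open ≡-Reasoning

  ·-comm : ∀ a b → a · b ≡ b · a
  ·-comm a b = cong (_mod n) (*-comm (toℕ a) (toℕ b))

  ·-identityˡ : ∀ a → 1ᵣ · a ≡ a
  ·-identityˡ a = begin
    1ᵣ · a               ≡⟨ cong (1ᵣ ·_) (mod-toℕ a) ⟨
    1ᵣ · (toℕ a mod n)   ≡⟨ mod-·-mod 1 (toℕ a) ⟩
    (1 * toℕ a) mod n    ≡⟨ cong (_mod n) (*-identityˡ (toℕ a)) ⟩
    toℕ a mod n          ≡⟨ mod-toℕ a ⟩
    a                    ∎
    where open ≡-Reasoning

  ·-identityʳ : ∀ a → a · 1ᵣ ≡ a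
  ·-identityʳ a = trans (·-comm a 1ᵣ) (·-identityˡ a)

  invertible⇒coprime : ∀ a b → a · b ≡ 1ᵣ → Coprime (toℕ a) n
  invertible⇒coprime a b ab≡1 {d} (d∣a , d∣n) =
    ∣1⇒≡1 (∣n∣m%n⇒∣m d∣n (subst (d ∣_) ab%n≡1%n (%-presˡ-∣ (∣-trans d∣a (m∣m*n (toℕ b))) d∣n)))
    where
    ab%n≡1%n : toℕ a * toℕ b % n ≡ 1 % n
    ab%n≡1%n = trans (sym (toℕ-mod _)) (trans (cong toℕ ab≡1) (toℕ-mod 1))

  inverse : ∀ a → Coprime (toℕ a) n → ∃ λ b → a · b ≡ 1ᵣ
  inverse a c with coprime-Bézout c
  ... | Bézout.+- s t 1+tn≡sa = s mod n , (begin
      a · (s mod n)              ≡⟨ cong (_· (s mod n)) (mod-toℕ a) ⟨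
      (toℕ a mod n) · (s mod n)  ≡⟨ mod-·-mod _ s ⟩
      (toℕ a * s) mod n          ≡⟨ cong (_mod n) (trans (*-comm (toℕ a) s) (sym 1+tn≡sa)) ⟩
      (1 + t * n) mod n          ≡⟨ mod-cong ([m+kn]%n≡m%n 1 t n) ⟩
      1 mod n                    ∎)
    where open ≡-Reasoning
  ... | Bézout.-+ s t 1+sa≡tn = (s * pred n) mod n , (begin
      a · ((s * pred n) mod n)                ≡⟨ cong (_· ((s * pred n) mod n)) (mod-toℕ a) ⟨
      (toℕ a mod n) · ((s * pred n) mod n)    ≡⟨ mod-·-mod _ (s * pred n) ⟩
      (toℕ a * (s * pred n)) mod n            ≡⟨ mod-cong ([m+kn]%n≡m%n _ t n) ⟨
      (toℕ a * (s * pred n) + t * n) mod n    ≡⟨ cong (_mod n) (cong (toℕ a * (s * pred n) +_) 1+sa≡tn) ⟨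
      (toℕ a * (s * pred n) + (1 + s * toℕ a)) mod n
                                              ≡⟨ cong (_mod n) (rearrange (toℕ a) s (pred n)) ⟩
      (1 + s * toℕ a * suc (pred n)) mod n    ≡⟨ cong (λ k → (1 + s * toℕ a * k) mod n) (suc-pred n) ⟩
      (1 + s * toℕ a * n) mod n               ≡⟨ mod-cong ([m+kn]%n≡m%n 1 (s * toℕ a) n) ⟩
      1 mod n                                 ∎)
    where
    open ≡-Reasoning
    rearrange : ∀ a s p → a * (s * p) + (1 + s * a) ≡ 1 + s * a * suc p
    rearrange = solve-∀

  -- The permutation π_a : j ↦ a j mod n.

  scale : (a : Fin n) → Coprime (toℕ a) n → Permutation′ n
  scale a c = permutation (a ·_) (b ·_) (cancel a b ab≡1) (cancel b a (trans (·-comm b a) ab≡1))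
    where
    b = proj₁ (inverse a c)
    ab≡1 = proj₂ (inverse a c)
    cancel : ∀ r s → r · s ≡ 1ᵣ → ∀ j → r · (s · j) ≡ j
    cancel r s rs≡1 j = trans (sym (·-assoc r s j)) (trans (cong (_· j) rs≡1) (·-identityˡ j))

  -- 𝒰 n = { π_a : 0 ≤ a < n, gcd (a, n) = 1 }, also for n = 1, where the
  -- only residue 0 is coprime to 1.

  scale? : Fin n → Maybe (Permutation′ n)
  scale? a with coprime? (toℕ a) n
  ... | yes c = just (scale a c)
  ... | no  _ = nothing

  scales : List (Permutation′ n)
  scales = mapMaybe scale? (allFin n)

  IsScale : Permutation′ n → Set
  IsScale π = Σ (Fin n) λ a → Coprime (toℕ a) n × (∀ j → π ⟨$⟩ʳ j ≡ a · j)

  isScale⇒∈ : ∀ {π} → IsScale π → Any (π ≈_) scales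
  isScale⇒∈ {π} (a , c , π≗a) = Any.mapMaybe⁺ scale? (allFin n) (Any.map⁺ (lose (∈-allFin a) hit))
    where
    hit : MAny.Any (π ≈_) (scale? a)
    hit with coprime? (toℕ a) n
    ... | yes _ = just π≗a
    ... | no ¬c = ⊥-elim (¬c c)

  ∈⇒isScale : ∀ {π} → π ∈ scales → IsScale π
  ∈⇒isScale = All.lookup (mapMaybe⁺ (map⁺ (All.universal hit (allFin n))))
    where
    hit : ∀ a → MAll.All IsScale (scale? a)
    hit a with coprime? (toℕ a) n
    ... | yes c = just (a , c , λ _ → refl)
    ... | no  _ = nothing

  scales-distinct : ∀ {as} → Unique as → AllPairs (λ π ρ → ¬ π ≈ ρ) (mapMaybe scale? as)
  scales-distinct [] = []
  scales-distinct {a ∷ as} (a∉as ∷ as!) with coprime? (toℕ a) n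
  ... | no  _ = scales-distinct as!
  ... | yes c = mapMaybe⁺ (map⁺ (All.map differs a∉as)) ∷ scales-distinct as!
    where
    differs : ∀ {b} → a ≢ b → MAll.All (λ ρ → ¬ scale a c ≈ ρ) (scale? b)
    differs {b} a≢b with coprime? (toℕ b) n
    ... | no  _ = nothing
    ... | yes _ = just λ eq →
      a≢b (trans (sym (·-identityʳ a)) (trans (eq 1ᵣ) (·-identityʳ b)))

  𝒰 : PermutationGroup n
  𝒰 = record
    { elements  = scales
    ; distinct  = scales-distinct (allFin⁺ n)
    ; id-closed = isScale⇒∈ {id}
        (1ᵣ , invertible⇒coprime 1ᵣ 1ᵣ (·-identityˡ 1ᵣ) , λ j → sym (·-identityˡ j))
    ; ∘-closed  = λ {π} {ρ} π∈ ρ∈ →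
        isScale⇒∈ {π ∘ₚ ρ} (∘-scale {π} {ρ} (∈⇒isScale π∈) (∈⇒isScale ρ∈))
    ; ⁻¹-closed = λ {π} π∈ → isScale⇒∈ {flip π} (flip-scale {π} (∈⇒isScale π∈))
    }
    where
    ∘-scale : ∀ {π ρ} → IsScale π → IsScale ρ → IsScale (π ∘ₚ ρ)
    ∘-scale {π} {ρ} (a , c , π≗a) (b , d , ρ≗b) =
      b · a , invertible⇒coprime (b · a) (a′ · b′) ba·a′b′≡1 ,
      λ j → trans (ρ≗b _) (trans (cong (b ·_) (π≗a j)) (sym (·-assoc b a j)))
      where
      a′ = proj₁ (inverse a c)
      b′ = proj₁ (inverse b d)
      open ≡-Reasoning
      ba·a′b′≡1 : (b · a) · (a′ · b′) ≡ 1ᵣ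
      ba·a′b′≡1 = begin
        (b · a) · (a′ · b′)  ≡⟨ ·-assoc b a _ ⟩
        b · (a · (a′ · b′))  ≡⟨ cong (b ·_) (·-assoc a a′ b′) ⟨
        b · ((a · a′) · b′)  ≡⟨ cong (λ r → b · (r · b′)) (proj₂ (inverse a c)) ⟩
        b · (1ᵣ · b′)        ≡⟨ cong (b ·_) (·-identityˡ b′) ⟩
        b · b′               ≡⟨ proj₂ (inverse b d) ⟩
        1ᵣ                   ∎

    flip-scale : ∀ {π} → IsScale π → IsScale (flip π)
    flip-scale {π} (a , c , π≗a) =
      b , invertible⇒coprime b a ba≡1 , λ j → begin
        π ⟨$⟩ˡ j              ≡⟨ ·-identityˡ _ ⟨
        1ᵣ · (π ⟨$⟩ˡ j)       ≡⟨ cong (_· (π ⟨$⟩ˡ j)) ba≡1 ⟨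
        (b · a) · (π ⟨$⟩ˡ j)  ≡⟨ ·-assoc b a _ ⟩
        b · (a · (π ⟨$⟩ˡ j))  ≡⟨ cong (b ·_) (π≗a _) ⟨
        b · (π ⟨$⟩ʳ (π ⟨$⟩ˡ j))
                              ≡⟨ cong (b ·_) (inverseʳ π) ⟩
        b · j                 ∎
      where
      b = proj₁ (inverse a c)
      ba≡1 = trans (·-comm b a) (proj₂ (inverse a c))
      open ≡-Reasoning

𝒵 : ℕ → Poly
𝒵 m = cycleIndex (𝒰 (2 ^ m) {{m^n≢0 2 m}})

1/2^ : ℕ → ℚ
1/2^ k = (1ℤ / 2 ^ k) {{m^n≢0 2 k}}

------------------------------------------------------------------------
-- The two sums of the closed form for m ≥ 3

𝒵₁ : ℕ → Poly
𝒵₁ m = x 1 ^ₚ (2 ^ m)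
    +ₚ nat (2 ^ (m ∸ 3)) *ₚ x 1 ^ₚ 2 *ₚ x 2 *ₚ (∏[ l ∈ [ 3 ⋯< m + 1 ] ] x (2 ^ (l ∸ 2)) ^ₚ 2)
    +ₚ (∑[ t ∈ [ 0 ⋯< m ∸ 3 ] ]
          nat (2 ^ t) *ₚ x 1 ^ₚ (2 ^ (m ∸ 1 ∸ t))
            *ₚ (∏[ i ∈ [ 0 ⋯< t + 1 ] ] x (2 ^ (i + 1)) ^ₚ (2 ^ (m ∸ 2 ∸ t))))

-- The first term is the ctype of j ↦ - j, which fixes 0 and 2^(m-1) and
-- swaps the other 2^m - 2 residues in pairs, so the exponent of x₂ is
-- (2^m - 2) / 2 = 2^(m-1) - 1. This corrects a misprint in the source,
-- which has the exponent 2^m - 2: with x_i in degree i every term of the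
-- cycle index has degree 2^m, whereas x₁² x₂^(2^m - 2) does not.

𝒵₂ : ℕ → Poly
𝒵₂ m = x 1 ^ₚ 2 *ₚ x 2 ^ₚ (2 ^ (m ∸ 1) ∸ 1)
    +ₚ nat (2 ^ (m ∸ 3)) *ₚ x 1 ^ₚ 4 *ₚ (∏[ l ∈ [ 3 ⋯< m + 1 ] ] x (2 ^ (l ∸ 2)) ^ₚ 2)
    +ₚ x 1 ^ₚ 2 *ₚ
       (∑[ t ∈ [ 0 ⋯< m ∸ 3 ] ]
          nat (2 ^ t) *ₚ x 2 ^ₚ (2 ^ (m ∸ t ∸ 1) ∸ 1)
            *ₚ (∏[ i ∈ [ 1 ⋯< t + 1 ] ] x (2 ^ (i + 1)) ^ₚ (2 ^ (m ∸ t ∸ 2))))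

{-# OPTIONS --safe #-}

-- Cycle type of π_a: the points of a cycle share the cycle's length as their
-- period, so the multiset of cycle lengths is recovered from the multiset of
-- periods of all points. For a = ±1 + 2^k w with w odd and k ≥ 2, one has
-- a^(2^e) = 1 + 2^(e+k) · odd for e ≥ 1. Hence the periods follow by
-- induction from modulus 2^k, where a acts as ±1: from modulus 2^(d+k) to
-- 2^(d+k+1), an even j behaves as j/2 did, and an odd j has period 2^(d+1).
-- Sum over 𝒰: the odd residues are 1 + 4b with 0 ≤ b < 2^(m-2) and -1 + 4b
-- with 0 < b ≤ 2^(m-2); b is 0 (respectively 2^(m-2)) or 2^s times an odd
-- number, and the cycle type depends only on the sign and on s.

module Submission where

open import Defs
open import Data.Nat.Base using (ℕ; _∸_; _≥_)
open import Data.Product.Base using (_×_)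
open import Data.Rational.Base using (½)
open import Relation.Binary.PropositionalEquality using (_≡_)

import Algebra.Solver.CommutativeMonoid as CommutativeMonoidSolver
open import Data.Bool.Base using (true; false)
open import Data.Bool.Properties using () renaming (_≟_ to _≟ᵇ_)
open import Data.Empty using (⊥-elim)
open import Data.Fin.Base as Fin using (Fin; toℕ)
open import Data.Fin.Permutation using (Permutation′; _⟨$⟩ʳ_; _⟨$⟩ˡ_; inverseˡ)
import Data.Fin.Properties as Fin
open import Data.Fin.Subset as Subset using (Subset; ⁅_⁆; ⋃; ∣_∣; _∪_)
import Data.Fin.Subset.Properties as Subset
open import Data.Integer.Base as ℤ using (1ℤ)
import Data.Integer.Properties as ℤ
open import Data.List.Base hiding (lookup; [_])
open import Data.List.Membership.Propositional using (_∈_)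
open import Data.List.Membership.Propositional.Properties
open import Data.List.Properties hiding (≡-dec)
open import Data.List.Relation.Binary.Permutation.Propositional as Perm
  using (_↭_; ↭-refl; ↭-sym; ↭-trans; ↭-reflexive; prep; module PermutationReasoning)
open import Data.List.Relation.Binary.Permutation.Propositional.Properties
  using (¬x∷xs↭[]; ∈-resp-↭; drop-∷; shift; shifts; ++⁺ˡ; ++⁺ʳ; map⁺; mapMaybe-↭; ↭-length;
         ++-commutativeMonoid)
open import Data.List.Relation.Unary.All as All using (All; []; _∷_)
import Data.List.Relation.Unary.All.Properties as All
open import Data.List.Relation.Unary.AllPairs using ([]; _∷_)
open import Data.List.Relation.Unary.Any using (here; there)
open import Data.List.Relation.Unary.Unique.DecPropositional.Properties using (deduplicate-!)
open import Data.List.Relation.Unary.Unique.Propositional using (Unique)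
import Data.List.Relation.Unary.Unique.Propositional.Properties as Unique
open import Data.Maybe.Base using (Maybe; just; nothing; maybe′)
open import Data.Nat.Base hiding (_⊔_; _/_; _%_)
open import Data.Nat.Coprimality using (Coprime; coprime?)
open import Data.Nat.DivMod using (_%_; _/_; _mod_; m%n<n; m≡m%n+[m/n]*n; [m+kn]%n≡m%n)
open import Data.Nat.Divisibility
open import Data.Nat.GeneralisedArithmetic using (fold; fold-+)
open import Data.Nat.Induction using (<-rec)
open import Data.Nat.Primality using (prime[2]; euclidsLemma)
open import Data.Nat.Properties hiding (_≟_)
import Data.Nat.Properties as ℕ
open import Data.Nat.Tactic.RingSolver using (solve-∀)
open import Data.Product.Base hiding (map)
open import Data.Rational.Base using (ℚ; 0ℚ; 1ℚ; toℚᵘ)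
  renaming (_+_ to _+ℚ_; _*_ to _*ℚ_; _/_ to _/ℚ_)
import Data.Rational.Properties as ℚ
import Data.Rational.Unnormalised.Base as ℚᵘ
import Data.Rational.Unnormalised.Properties as ℚᵘ
open import Data.Sum.Base using (inj₁; inj₂; [_,_]′)
open import Data.Vec.Base as Vec using ([]; _∷_)
open import Data.Vec.Properties using (≡-dec)
open import Function.Base using (_∘_; id)
open import Relation.Binary.Bundles using (Setoid)
open import Relation.Binary.Definitions using (DecidableEquality)
open import Relation.Binary.PropositionalEquality hiding ([_])
import Relation.Binary.Reasoning.Setoid as SetoidReasoning
open import Relation.Nullary
open import Relation.Nullary.Decidable using (¬?)
import Relation.Unary as U

-- Multisets as lists

-- Numbers of points are never divided by cycle lengths: a proposed multiset of lengths is expanded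
-- to one entry per point, compared with the periods, and the expansion is then cancelled. Squaring
-- 1 + 2^k w, w odd, gains exactly one factor 2 only when k ≥ 2, which is why the units are written
-- as 1 + 4b and -1 + 4b and not as 1 + 2b. Near -1 this gain sets in only after a first squaring;
-- `Doubling` is the common interface for both signs. The two halves of the closed form do not
-- separate the signs: the summand 2^(m-3) x_1^2 x_2 ... of `𝒵₁` comes from -1 + 4b with b odd, and
-- 2^(m-3) x_1^4 ... of `𝒵₂` from 1 + 4b with b odd.

filter-++-∁-↭ : ∀ {A : Set} {P : A → Set} (P? : U.Decidable P) xs →
                xs ↭ filter P? xs ++ filter (¬? ∘ P?) xs
filter-++-∁-↭ P? [] = ↭-refl
filter-++-∁-↭ P? (y ∷ ys) with P? y
... | yes _ = prep y (filter-++-∁-↭ P? ys)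
... | no  _ = ↭-trans (prep y (filter-++-∁-↭ P? ys)) (↭-sym (shift y (filter P? ys) _))

filter-⊆-filter : ∀ {A : Set} {P Q : A → Set} (P? : U.Decidable P) (Q? : U.Decidable Q) →
                  (∀ {y} → P y → Q y) → ∀ xs → filter P? (filter Q? xs) ≡ filter P? xs
filter-⊆-filter P? Q? P⊆Q [] = refl
filter-⊆-filter P? Q? P⊆Q (y ∷ ys) with Q? y
... | no ¬q = trans (filter-⊆-filter P? Q? P⊆Q ys) (sym (filter-reject P? (¬q ∘ P⊆Q)))
... | yes _ with P? y
...   | yes _ = cong (y ∷_) (filter-⊆-filter P? Q? P⊆Q ys)
...   | no  _ = filter-⊆-filter P? Q? P⊆Q ys

module _ {A : Set} (_≟_ : DecidableEquality A) where

  -- Filtering out the class of c leaves the other classes intact, since no entry equals both c and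
  -- d. This is applied to the cycles of all points and to the list of cycle lengths.
  ↭-classes : ∀ {cs ys} → Unique cs → All (_∈ cs) ys →
              ys ↭ concatMap (λ c → filter (c ≟_) ys) cs
  ↭-classes {[]} {[]} _ _ = ↭-refl
  ↭-classes {[]} {_ ∷ _} _ (() ∷ _)
  ↭-classes {c ∷ cs} {ys} (c∉cs ∷ cs!) ys⊆ = begin
    ys                                                   ↭⟨ filter-++-∁-↭ (c ≟_) ys ⟩
    filter (c ≟_) ys ++ zs                               ↭⟨ ++⁺ˡ _ (↭-classes cs! zs⊆) ⟩
    filter (c ≟_) ys ++ concatMap (λ d → filter (d ≟_) zs) cs
      ≡⟨ cong (λ l → filter (c ≟_) ys ++ concat l) (map-cong-local (All.map skip c∉cs)) ⟩
    filter (c ≟_) ys ++ concatMap (λ d → filter (d ≟_) ys) cs ∎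
    where
    open PermutationReasoning
    zs = filter (¬? ∘ (c ≟_)) ys
    zs⊆ : All (_∈ cs) zs
    zs⊆ = All.tabulate λ z∈zs → let z∈ys , c≢z = ∈-filter⁻ (¬? ∘ (c ≟_)) {xs = ys} z∈zs in
      below c≢z (All.lookup ys⊆ z∈ys)
      where
      below : ∀ {z} → c ≢ z → z ∈ c ∷ cs → z ∈ cs
      below c≢z (here z≡c) = ⊥-elim (c≢z (sym z≡c))
      below c≢z (there z∈) = z∈
    skip : ∀ {d} → c ≢ d → filter (d ≟_) zs ≡ filter (d ≟_) ys
    skip c≢d = filter-⊆-filter (_ ≟_) (¬? ∘ (c ≟_)) (λ d≡y c≡y → c≢d (trans c≡y (sym d≡y))) ys

all-≡⇒replicate : ∀ {A : Set} {y : A} {ys} → All (_≡ y) ys → ys ≡ replicate (length ys) y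
all-≡⇒replicate [] = refl
all-≡⇒replicate (refl ∷ eqs) = cong (_ ∷_) (all-≡⇒replicate eqs)

filter-≟-replicate : ∀ {A : Set} (_≟_ : DecidableEquality A) c ys →
  filter (c ≟_) ys ≡ replicate (length (filter (c ≟_) ys)) c
filter-≟-replicate _≟_ c ys = all-≡⇒replicate (All.map sym (All.all-filter (c ≟_) ys))

++-cancelˡ-↭ : ∀ {A : Set} (xs : List A) {ys zs} → xs ++ ys ↭ xs ++ zs → ys ↭ zs
++-cancelˡ-↭ [] p = p
++-cancelˡ-↭ (y ∷ xs) p = ++-cancelˡ-↭ xs (drop-∷ p)

-- The cycle lengths, each repeated once for every point of its cycle.

inflate : List ℕ → List ℕ
inflate = concatMap (λ s → replicate s s)

inflate-++ : ∀ us vs → inflate (us ++ vs) ≡ inflate us ++ inflate vs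
inflate-++ = concatMap-++ (λ s → replicate s s)

replicate-+ : ∀ {A : Set} j k {y : A} → replicate (j + k) y ≡ replicate j y ++ replicate k y
replicate-+ zero k = refl
replicate-+ (suc j) k = cong (_ ∷_) (replicate-+ j k)

inflate-replicate : ∀ k s → inflate (replicate k s) ≡ replicate (k * s) s
inflate-replicate zero s = refl
inflate-replicate (suc k) s =
  trans (cong (replicate s s ++_) (inflate-replicate k s)) (sym (replicate-+ s (k * s)))

∈-inflate⁻ : ∀ {s} us → s ∈ inflate us → s ∈ us
∈-inflate⁻ (v ∷ us) s∈ with ∈-++⁻ (replicate v v) s∈
... | inj₁ s∈v = here (All.lookup (All.replicate⁺ {P = _≡ v} v refl) s∈v)
... | inj₂ s∈us = there (∈-inflate⁻ us s∈us)

-- A value s can occur in `inflate vs` only inside the block of an entry s of `vs`; that block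
-- cancels against the block of the head of `us`. Zeros have empty blocks and would be invisible,
-- hence the positivity.
inflate-cancel : ∀ {us vs} → All (0 <_) us → All (0 <_) vs → inflate us ↭ inflate vs → us ↭ vs
inflate-cancel {[]} {[]} _ _ _ = ↭-refl
inflate-cancel {[]} {zero ∷ vs} _ (() ∷ _)
inflate-cancel {[]} {suc v ∷ vs} _ _ p = ⊥-elim (¬x∷xs↭[] (↭-sym p))
inflate-cancel {suc s ∷ us} {vs} (_ ∷ us≢0) vs≢0 p
  with v₁ , v₂ , refl ← ∈-∃++ (∈-inflate⁻ vs (∈-resp-↭ p (here refl))) =
  ↭-trans (prep (suc s) (inflate-cancel us≢0
             (All.++⁺ (All.++⁻ˡ v₁ vs≢0) (All.tail (All.++⁻ʳ v₁ vs≢0))) q))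
          (↭-sym (shift (suc s) v₁ v₂))
  where
  open PermutationReasoning
  q : inflate us ↭ inflate (v₁ ++ v₂)
  q = ++-cancelˡ-↭ (replicate (suc s) (suc s)) (begin
    replicate (suc s) (suc s) ++ inflate us          ↭⟨ p ⟩
    inflate (v₁ ++ suc s ∷ v₂)                       ≡⟨ inflate-++ v₁ (suc s ∷ v₂) ⟩
    inflate v₁ ++ replicate (suc s) (suc s) ++ inflate v₂
      ↭⟨ shifts (inflate v₁) (replicate (suc s) (suc s)) ⟩
    replicate (suc s) (suc s) ++ inflate v₁ ++ inflate v₂
      ≡⟨ cong (replicate (suc s) (suc s) ++_) (inflate-++ v₁ v₂) ⟨
    replicate (suc s) (suc s) ++ inflate (v₁ ++ v₂)  ∎)

concatMap-upTo-suc : ∀ {A : Set} (f : ℕ → List A) n →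
                     concatMap f (upTo (suc n)) ≡ concatMap f (upTo n) ++ f n
concatMap-upTo-suc f n = begin
  concatMap f (upTo (suc n))       ≡⟨ cong (concatMap f) (upTo-∷ʳ n) ⟨
  concatMap f (upTo n ++ n ∷ [])   ≡⟨ concatMap-++ f (upTo n) (n ∷ []) ⟩
  concatMap f (upTo n) ++ f n ++ []
                                   ≡⟨ cong (concatMap f (upTo n) ++_) (++-identityʳ (f n)) ⟩
  concatMap f (upTo n) ++ f n      ∎
  where open ≡-Reasoning

upTo-+ : ∀ j k → upTo (j + k) ≡ upTo j ++ map (j +_) (upTo k)
upTo-+ j k = trans (go id j) (cong (upTo j ++_) (sym (map-upTo (j +_) k)))
  where
  go : ∀ (f : ℕ → ℕ) j → applyUpTo f (j + k) ≡ applyUpTo f j ++ applyUpTo (λ i → f (j + i)) k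
  go f zero = refl
  go f (suc j) = cong (f 0 ∷_) (go (f ∘ suc) j)

-- Serves three purposes: lifting periods to the doubled modulus, discarding the non-units, and
-- sorting a sum by 2-adic valuation.
upTo-parity : ∀ h → upTo (2 * h) ↭ map (2 *_) (upTo h) ++ map (λ i → suc (2 * i)) (upTo h)
upTo-parity zero = ↭-refl
upTo-parity (suc h) = begin
  upTo (2 * suc h)   ≡⟨ cong upTo (trans (*-suc 2 h) (+-comm 2 (2 * h))) ⟩
  upTo (2 * h + 2)   ≡⟨ upTo-+ (2 * h) 2 ⟩
  upTo (2 * h) ++ (2 * h + 0) ∷ (2 * h + 1) ∷ []
    ≡⟨ cong₂ (λ p q → upTo (2 * h) ++ p ∷ q ∷ []) (+-identityʳ (2 * h)) (+-comm (2 * h) 1) ⟩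
  upTo (2 * h) ++ 2 * h ∷ suc (2 * h) ∷ []
    ↭⟨ ++⁺ʳ (2 * h ∷ suc (2 * h) ∷ []) (upTo-parity h) ⟩
  (E ++ O) ++ 2 * h ∷ suc (2 * h) ∷ []        ≡⟨ ++-assoc E O _ ⟩
  E ++ O ++ 2 * h ∷ suc (2 * h) ∷ []          ↭⟨ ++⁺ˡ E (shift (2 * h) O (suc (2 * h) ∷ [])) ⟩
  E ++ (2 * h ∷ []) ++ O ++ suc (2 * h) ∷ []  ≡⟨ ++-assoc E (2 * h ∷ []) _ ⟨
  (E ++ 2 * h ∷ []) ++ O ++ suc (2 * h) ∷ []
    ≡⟨ cong₂ _++_ (snoc (2 *_)) (snoc (λ i → suc (2 * i))) ⟩
  map (2 *_) (upTo (suc h)) ++ map (λ i → suc (2 * i)) (upTo (suc h)) ∎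
  where
  open PermutationReasoning
  E = map (2 *_) (upTo h)
  O = map (λ i → suc (2 * i)) (upTo h)
  snoc : ∀ (f : ℕ → ℕ) → map f (upTo h) ++ f h ∷ [] ≡ map f (upTo (suc h))
  snoc f = trans (sym (map-++ f (upTo h) (h ∷ []))) (cong (map f) (upTo-∷ʳ h))

-- Cycles of a permutation

least : ∀ {P : ℕ → Set} → U.Decidable P → ∀ n → P n →
        ∃ λ l → l ≤ n × P l × (∀ {t} → t < l → ¬ P t)
least {P} P? = <-rec _ step
  where
  step : ∀ n → (∀ {i} → i < n → P i → ∃ λ l → l ≤ i × P l × (∀ {t} → t < l → ¬ P t)) →
         P n → ∃ λ l → l ≤ n × P l × (∀ {t} → t < l → ¬ P t)
  step n rec pn with anyUpTo? P? n
  ... | no  none = n , ≤-refl , pn , λ t<n pt → none (_ , t<n , pt)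
  ... | yes (i , i<n , pi) with l , l≤i , pl , min ← rec i<n pi =
    l , ≤-trans l≤i (<⇒≤ i<n) , pl , min

∈-⋃-⁅⁆⁺ : ∀ {n} {k : Fin n} {ks} → k ∈ ks → k Subset.∈ ⋃ (map ⁅_⁆ ks)
∈-⋃-⁅⁆⁺ (here refl) = Subset.x∈p∪q⁺ (inj₁ (Subset.x∈⁅x⁆ _))
∈-⋃-⁅⁆⁺ (there k∈) = Subset.x∈p∪q⁺ (inj₂ (∈-⋃-⁅⁆⁺ k∈))

∈-⋃-⁅⁆⁻ : ∀ {n} {k : Fin n} ks → k Subset.∈ ⋃ (map ⁅_⁆ ks) → k ∈ ks
∈-⋃-⁅⁆⁻ [] k∈ = ⊥-elim (Subset.∉⊥ k∈)
∈-⋃-⁅⁆⁻ (i ∷ ks) k∈ with Subset.x∈p∪q⁻ ⁅ i ⁆ _ k∈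
... | inj₁ k∈i  = here (Subset.x∈⁅y⁆⇒x≡y i k∈i)
... | inj₂ k∈ks = there (∈-⋃-⁅⁆⁻ ks k∈ks)

∣⁅x⁆∪p∣ : ∀ {n} (i : Fin n) (p : Subset n) → ¬ i Subset.∈ p → ∣ ⁅ i ⁆ ∪ p ∣ ≡ suc ∣ p ∣
∣⁅x⁆∪p∣ Fin.zero (true ∷ p) i∉ = ⊥-elim (i∉ Vec.here)
∣⁅x⁆∪p∣ Fin.zero (false ∷ p) i∉ = cong (suc ∘ ∣_∣) (Subset.∪-identityˡ p)
∣⁅x⁆∪p∣ (Fin.suc i) (true ∷ p) i∉ = cong suc (∣⁅x⁆∪p∣ i p (i∉ ∘ Vec.there))
∣⁅x⁆∪p∣ (Fin.suc i) (false ∷ p) i∉ = ∣⁅x⁆∪p∣ i p (i∉ ∘ Vec.there)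

∣⋃-⁅⁆∣ : ∀ {n} {ks : List (Fin n)} → Unique ks → ∣ ⋃ (map ⁅_⁆ ks) ∣ ≡ length ks
∣⋃-⁅⁆∣ {n} [] = Subset.∣⊥∣≡0 n
∣⋃-⁅⁆∣ {ks = k ∷ ks} (k∉ ∷ ks!) =
  trans (∣⁅x⁆∪p∣ k _ (λ k∈ → All.lookup k∉ (∈-⋃-⁅⁆⁻ ks k∈) refl)) (cong suc (∣⋃-⁅⁆∣ ks!))

zero∉outside : ∀ {n} {p : Subset n} → ¬ Fin.zero Subset.∈ (false ∷ p)
zero∉outside ()

-- Used with `g` sending a point to its cycle and `P` testing for a given cycle: the number of hits
-- is then the size of that cycle as a subset.
length-filter-tabulate : ∀ {A : Set} {P : A → Set} (P? : U.Decidable P) {n} (g : Fin n → A) (p : Subset n) →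
  (∀ i → P (g i) → i Subset.∈ p) → (∀ {i} → i Subset.∈ p → P (g i)) →
  length (filter P? (tabulate g)) ≡ ∣ p ∣
length-filter-tabulate P? g [] ⇒ ⇐ = refl
length-filter-tabulate P? g (true ∷ p) ⇒ ⇐
  rewrite filter-accept P? {xs = tabulate (g ∘ Fin.suc)} (⇐ Vec.here) =
  cong suc (length-filter-tabulate P? (g ∘ Fin.suc) p (λ i → Subset.drop-there ∘ ⇒ (Fin.suc i)) (⇐ ∘ Vec.there))
length-filter-tabulate P? g (false ∷ p) ⇒ ⇐
  rewrite filter-reject P? {xs = tabulate (g ∘ Fin.suc)} (λ pz → zero∉outside (⇒ Fin.zero pz)) =
  length-filter-tabulate P? (g ∘ Fin.suc) p (λ i → Subset.drop-there ∘ ⇒ (Fin.suc i)) (⇐ ∘ Vec.there)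

iterate≡applyUpTo : ∀ {A : Set} (f : A → A) j n → iterate f j n ≡ applyUpTo (fold j f) n
iterate≡applyUpTo f j zero = refl
iterate≡applyUpTo f j (suc n) = cong (j ∷_) (trans (iterate≡applyUpTo f (f j) n) (go id n))
  where
  go : ∀ (h : ℕ → ℕ) n → applyUpTo (fold (f j) f ∘ h) n ≡ applyUpTo (λ t → f (fold j f (h t))) n
  go h zero = refl
  go h (suc n) = cong₂ _∷_ (shift-start (h 0)) (go (h ∘ suc) n)
    where
    shift-start : ∀ t → fold (f j) f t ≡ f (fold j f t)
    shift-start zero = refl
    shift-start (suc t) = cong f (shift-start t)

module _ {N : ℕ} (π : Permutation′ N) where

  private
    f = π ⟨$⟩ʳ_

  -- Phrased by divisibility and not by leastness, so that it translates directly into a congruence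
  -- condition on the powers of a multiplier.
  IsPeriod : Fin N → ℕ → Set
  IsPeriod j q = ∀ t → (fold j f t ≡ j → q ∣ t) × (q ∣ t → fold j f t ≡ j)

  f-injective : ∀ {j k} → f j ≡ f k → j ≡ k
  f-injective eq = trans (sym (inverseˡ π)) (trans (cong (π ⟨$⟩ˡ_) eq) (inverseˡ π))

  fold-injective : ∀ t {j k} → fold j f t ≡ fold k f t → j ≡ k
  fold-injective zero    eq = eq
  fold-injective (suc t) eq = fold-injective t (f-injective eq)

  fold-cancel : ∀ {j s t} → s ≤ t → fold j f s ≡ fold j f t → fold j f (t ∸ s) ≡ j
  fold-cancel {j} {s} {t} s≤t eq = fold-injective s (begin
    fold (fold j f (t ∸ s)) f s ≡⟨ fold-+ j f s ⟨
    fold j f (s + (t ∸ s))      ≡⟨ cong (fold j f) (m+[n∸m]≡n s≤t) ⟩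
    fold j f t                  ≡⟨ eq ⟨
    fold j f s                  ∎)
    where open ≡-Reasoning

  -- Among the N + 1 times 0, ..., N two give the same point, and cancelling the smaller leaves a
  -- positive return time of at most N. The least one is written `suc l`, which keeps it positive by
  -- construction.
  first-return : ∀ j → ∃ λ l → l < N × fold j f (suc l) ≡ j ×
                               (∀ {t} → t < l → fold j f (suc t) ≢ j)
  first-return j with s , t , s<t , eq ← Fin.pigeonhole (n<1+n N) (fold j f ∘ toℕ)
    with toℕ t ∸ toℕ s in d | fold-cancel (<⇒≤ s<t) eq
  ... | zero  | _   = ⊥-elim (<⇒≱ s<t (m∸n≡0⇒m≤n d))
  ... | suc e | ret
    with l , l≤e , ret′ , min ← least (λ t → fold j f (suc t) Fin.≟ j) e ret =
    l , ≤-trans (s≤s l≤e) (≤-trans (≤-reflexive (sym d)) (≤-trans (m∸n≤m (toℕ t) (toℕ s)) (s≤s⁻¹ (Fin.toℕ<n t))))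
      , ret′ , min

  fold-*-return : ∀ {j l} → fold j f l ≡ j → ∀ q → fold j f (q * l) ≡ j
  fold-*-return ret zero = refl
  fold-*-return {j} {l} ret (suc q) =
    trans (fold-+ j f l) (trans (cong (λ k → fold k f l) (fold-*-return ret q)) ret)

  module _ (j : Fin N) where

    private
      l = proj₁ (first-return j)
      L = suc l
      ret = proj₁ (proj₂ (proj₂ (first-return j)))
      min = proj₂ (proj₂ (proj₂ (first-return j)))

    fold-% : ∀ t → fold j f t ≡ fold j f (t % L)
    fold-% t = begin
      fold j f t                            ≡⟨ cong (fold j f) (m≡m%n+[m/n]*n t L) ⟩
      fold j f (t % L + t / L * L)          ≡⟨ fold-+ j f (t % L) ⟩
      fold (fold j f (t / L * L)) f (t % L) ≡⟨ cong (λ k → fold k f (t % L)) (fold-*-return ret (t / L)) ⟩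
      fold j f (t % L)                      ∎
      where open ≡-Reasoning

    L-isPeriod : IsPeriod j L
    L-isPeriod t = to , λ { (divides q refl) → fold-*-return ret q }
      where
      to : fold j f t ≡ j → L ∣ t
      to eq with t % L in r | m%n<n t L | fold-% t
      ... | zero  | _  | _   = m%n≡0⇒n∣m t L r
      ... | suc s | lt | eq′ = ⊥-elim (min (s≤s⁻¹ lt) (trans (sym eq′) eq))

    orbit : List (Fin N)
    orbit = applyUpTo (fold j f) L

    orbit-unique : Unique orbit
    orbit-unique = Unique.applyUpTo⁺₁ (fold j f) L distinct
      where
      distinct : ∀ {s t} → s < t → t < L → fold j f s ≢ fold j f t
      distinct {s} {t} s<t t<L eq with t ∸ s in d | fold-cancel (<⇒≤ s<t) eq
      ... | zero  | _    = <⇒≱ s<t (m∸n≡0⇒m≤n d)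
      ... | suc e | ret′ =
        min (s≤s⁻¹ (≤-trans (s≤s (≤-trans (≤-reflexive (sym d)) (m∸n≤m t s))) t<L)) ret′

    -- `cycleOf` collects only N iterates; they suffice because t can be reduced modulo the return
    -- time L, and L ≤ N.
    fold∈cycleOf : ∀ t → fold j f t Subset.∈ cycleOf π j
    fold∈cycleOf t = ∈-⋃-⁅⁆⁺ (subst₂ _∈_ (sym (fold-% t)) (sym (iterate≡applyUpTo f j N))
      (∈-applyUpTo⁺ (fold j f) (≤-trans (m%n<n t L) (proj₁ (proj₂ (first-return j))))))

    ∈cycleOf⇒fold : ∀ {k} → k Subset.∈ cycleOf π j → ∃ λ t → k ≡ fold j f t
    ∈cycleOf⇒fold k∈ with t , _ , eq ← ∈-applyUpTo⁻ (fold j f)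
      (subst (_ ∈_) (iterate≡applyUpTo f j N) (∈-⋃-⁅⁆⁻ (iterate f j N) k∈)) = t , eq

    cycleOf≡orbit : cycleOf π j ≡ ⋃ (map ⁅_⁆ orbit)
    cycleOf≡orbit = Subset.⊆-antisym
      (λ k∈ → let t , eq = ∈cycleOf⇒fold k∈ in
        ∈-⋃-⁅⁆⁺ (subst (_∈ orbit) (sym (trans eq (fold-% t))) (∈-applyUpTo⁺ (fold j f) (m%n<n t L))))
      (λ k∈ → let t , _ , eq = ∈-applyUpTo⁻ (fold j f) {n = L} (∈-⋃-⁅⁆⁻ orbit k∈) in
        subst (Subset._∈ cycleOf π j) (sym eq) (fold∈cycleOf t))

    ∣cycleOf∣≡L : ∣ cycleOf π j ∣ ≡ L
    ∣cycleOf∣≡L = begin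
      ∣ cycleOf π j ∣         ≡⟨ cong ∣_∣ cycleOf≡orbit ⟩
      ∣ ⋃ (map ⁅_⁆ orbit) ∣   ≡⟨ ∣⋃-⁅⁆∣ orbit-unique ⟩
      length orbit            ≡⟨ length-applyUpTo (fold j f) L ⟩
      L                       ∎
      where open ≡-Reasoning

    0<∣cycleOf∣ : 0 < ∣ cycleOf π j ∣
    0<∣cycleOf∣ = subst (0 <_) (sym ∣cycleOf∣≡L) z<s

    ∣cycleOf∣-isPeriod : IsPeriod j ∣ cycleOf π j ∣
    ∣cycleOf∣-isPeriod = subst (IsPeriod j) (sym ∣cycleOf∣≡L) L-isPeriod

    ∈cycleOf-sym : ∀ {k} → k Subset.∈ cycleOf π j → ∃ λ s → j ≡ fold k f s
    -- After t steps away from j, another `t * l` steps make `t * L` in all, which is t full turns.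
    ∈cycleOf-sym k∈ with t , refl ← ∈cycleOf⇒fold k∈ = t * l , sym (begin
      fold (fold j f t) f (t * l)  ≡⟨ fold-+ j f (t * l) ⟨
      fold j f (t * l + t)         ≡⟨ cong (fold j f) (trans (+-comm (t * l) t) (sym (*-suc t l))) ⟩
      fold j f (t * L)             ≡⟨ fold-*-return ret t ⟩
      j                            ∎)
      where open ≡-Reasoning

  cycleOf-⊆ : ∀ {j k} t → k ≡ fold j f t → cycleOf π k Subset.⊆ cycleOf π j
  cycleOf-⊆ {j} {k} t refl i∈ with s , refl ← ∈cycleOf⇒fold k i∈ =
    subst (Subset._∈ cycleOf π j) (fold-+ j f s) (fold∈cycleOf j (s + t))

  ∈cycleOf⇒≡ : ∀ {j k} → k Subset.∈ cycleOf π j → cycleOf π j ≡ cycleOf π k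
  ∈cycleOf⇒≡ {j} k∈ with t , k≡ ← ∈cycleOf⇒fold j k∈ | s , j≡ ← ∈cycleOf-sym j k∈ =
    Subset.⊆-antisym (cycleOf-⊆ s j≡) (cycleOf-⊆ t k≡)

  private
    _≟ˢ_ : DecidableEquality (Subset N)
    _≟ˢ_ = ≡-dec _≟ᵇ_
    cyc = map (cycleOf π) (allFin N)

  ∈cycles⇒ : ∀ {c} → c ∈ cycles π → ∃ λ j → c ≡ cycleOf π j
  ∈cycles⇒ c∈ with j , _ , eq ← ∈-map⁻ (cycleOf π) (∈-deduplicate⁻ _≟ˢ_ cyc c∈) = j , eq

  -- A point lies in its own cycle, and a cycle is the cycle of each of its points; so the points
  -- with the same cycle as j are exactly the members of that cycle.
  class-size : ∀ j → length (filter (cycleOf π j ≟ˢ_) cyc) ≡ ∣ cycleOf π j ∣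
  class-size j = trans (cong (length ∘ filter (cycleOf π j ≟ˢ_)) (map-tabulate id (cycleOf π)))
    (length-filter-tabulate (cycleOf π j ≟ˢ_) (cycleOf π) (cycleOf π j)
      (λ i eq → subst (i Subset.∈_) (sym eq) (fold∈cycleOf i 0)) ∈cycleOf⇒≡)

  -- Each cycle c belongs to |c| points, so grouping the points by cycle gives |c| entries |c|,
  -- which is what `inflate` makes of the single entry |c|.
  inflate-cycles : inflate (map ∣_∣ (cycles π)) ↭ map (∣_∣ ∘ cycleOf π) (allFin N)
  inflate-cycles = ↭-sym (begin
    map (∣_∣ ∘ cycleOf π) (allFin N)                ≡⟨ map-∘ (allFin N) ⟩
    map ∣_∣ cyc
      ↭⟨ map⁺ ∣_∣ (↭-classes _≟ˢ_ (deduplicate-! _≟ˢ_ cyc) (All.tabulate (∈-deduplicate⁺ _≟ˢ_))) ⟩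
    map ∣_∣ (concatMap (λ c → filter (c ≟ˢ_) cyc) (cycles π))
      ≡⟨ cong (map ∣_∣ ∘ concat) (map-cong-local (All.tabulate class)) ⟩
    map ∣_∣ (concatMap (λ c → replicate ∣ c ∣ c) (cycles π))
      ≡⟨ map-concatMap ∣_∣ (λ c → replicate ∣ c ∣ c) (cycles π) ⟩
    concatMap (λ c → map ∣_∣ (replicate ∣ c ∣ c)) (cycles π)
      ≡⟨ concatMap-cong (λ c → map-replicate ∣_∣ ∣ c ∣ c) (cycles π) ⟩
    concatMap (λ c → replicate ∣ c ∣ ∣ c ∣) (cycles π)
      ≡⟨ concatMap-map (λ s → replicate s s) ∣_∣ (cycles π) ⟨
    inflate (map ∣_∣ (cycles π)) ∎)
    where
    open PermutationReasoning
    class : ∀ {c} → c ∈ cycles π → filter (c ≟ˢ_) cyc ≡ replicate ∣ c ∣ c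
    class c∈ with j , refl ← ∈cycles⇒ c∈ =
      trans (filter-≟-replicate _≟ˢ_ (cycleOf π j) cyc) (cong (λ s → replicate s (cycleOf π j)) (class-size j))

  cycle-lengths : All (λ s → 0 < s × s ≤ N) (map ∣_∣ (cycles π))
  cycle-lengths = All.map⁺ (All.tabulate bounds)
    where
    bounds : ∀ {c} → c ∈ cycles π → 0 < ∣ c ∣ × ∣ c ∣ ≤ N
    bounds {c} c∈ with j , refl ← ∈cycles⇒ c∈ = 0<∣cycleOf∣ j , Subset.∣p∣≤n c

-- Cycle types as monomials

mono : Monomial → Poly
mono u = (1ℚ , u) ∷ []

x-^ : ∀ i k → x i ^ₚ k ≡ mono (replicate k i)
x-^ i zero = refl
x-^ i (suc k) = cong (x i *ₚ_) (x-^ i k)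

∏-x-^ : ∀ {A : Set} (g h : A → ℕ) is →
        (∏[ i ∈ is ] x (g i) ^ₚ h i) ≡ mono (concatMap (λ i → replicate (h i) (g i)) is)
∏-x-^ g h [] = refl
∏-x-^ g h (i ∷ is) = cong₂ _*ₚ_ (x-^ (g i) (h i)) (∏-x-^ g h is)

length-filter-map : ∀ {A B : Set} {P : B → Set} {Q : A → Set} (P? : U.Decidable P) (Q? : U.Decidable Q)
  (g : A → B) → (∀ {y} → P (g y) → Q y) → (∀ {y} → Q y → P (g y)) →
  ∀ ys → length (filter P? (map g ys)) ≡ length (filter Q? ys)
length-filter-map P? Q? g ⇒ ⇐ [] = refl
length-filter-map P? Q? g ⇒ ⇐ (y ∷ ys) with Q? y
... | yes q = trans (cong length (filter-accept P? (⇐ q))) (cong suc (length-filter-map P? Q? g ⇒ ⇐ ys))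
... | no ¬q = trans (cong length (filter-reject P? (¬q ∘ ⇒))) (length-filter-map P? Q? g ⇒ ⇐ ys)

-- `ctype` lists the cycle lengths sorted by value; all of them lie between 1 and N, so the product
-- over that range loses none.
ctype-mono : ∀ {N} (π : Permutation′ N) → ∃ λ u → ctype π ≡ mono u × u ↭ map ∣_∣ (cycles π)
ctype-mono {N} π = _ , ∏-x-^ id (cycleCount π) [ 1 ⋯< suc N ] , ↭-sym (begin
  S                                                         ↭⟨ ↭-classes ℕ._≟_ range! S⊆ ⟩
  concatMap (λ i → filter (i ℕ.≟_) S) [ 1 ⋯< suc N ]        ≡⟨ concatMap-cong class [ 1 ⋯< suc N ] ⟩
  concatMap (λ i → replicate (cycleCount π i) i) [ 1 ⋯< suc N ] ∎)
  where
  open PermutationReasoning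
  S = map ∣_∣ (cycles π)
  range! : Unique [ 1 ⋯< suc N ]
  range! = Unique.applyUpTo⁺₁ suc N (λ i<j _ → <⇒≢ (s<s i<j))
  S⊆ : All (_∈ [ 1 ⋯< suc N ]) S
  S⊆ = All.map (λ { {suc s} (_ , s≤N) → ∈-applyUpTo⁺ suc s≤N }) (cycle-lengths π)
  class : ∀ i → filter (i ℕ.≟_) S ≡ replicate (cycleCount π i) i
  class i = trans (filter-≟-replicate ℕ._≟_ i S)
    (cong (λ k → replicate k i) (length-filter-map (i ℕ.≟_) (λ c → ∣ c ∣ ℕ.≟ i) ∣_∣ sym sym (cycles π)))

-- Multiplication modulo a power of two

-- If the cofactor r of q is even, a factor 2 cancels and q divides 2^e after all; if r is odd,
-- Euclid's lemma puts the 2 into q and the claim descends to q/2. A period is thus pinned down by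
-- returning at time 2^(e+1) but not at time 2^e.
∣2^⇒≡2^ : ∀ e {q} → q ∣ 2 ^ suc e → ¬ q ∣ 2 ^ e → q ≡ 2 ^ suc e
∣2^⇒≡2^ e {q} (divides r 2^≡rq) ¬q∣ with 2 ∣? r
... | yes (divides s refl) = ⊥-elim (¬q∣ (divides s (*-cancelˡ-≡ _ _ 2 (trans 2^≡rq (rearrange s q)))))
  where
  rearrange : ∀ s q → s * 2 * q ≡ 2 * (s * q)
  rearrange = solve-∀
... | no ¬2∣r with euclidsLemma r q prime[2] (divides (2 ^ e) (trans (sym 2^≡rq) (*-comm 2 (2 ^ e))))
...   | inj₁ 2∣r = ⊥-elim (¬2∣r 2∣r)
...   | inj₂ (divides q′ refl) = trans (*-comm q′ 2) (cong (2 *_) (go e q′∣ ¬q∣))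
  where
  rearrange : ∀ r q′ → r * (q′ * 2) ≡ 2 * (r * q′)
  rearrange = solve-∀
  q′∣ : q′ ∣ 2 ^ e
  q′∣ = divides r (*-cancelˡ-≡ _ _ 2 (trans 2^≡rq (rearrange r q′)))
  go : ∀ e → q′ ∣ 2 ^ e → ¬ q′ * 2 ∣ 2 ^ e → q′ ≡ 2 ^ e
  go zero q′∣ _ = ∣1⇒≡1 q′∣
  go (suc e) q′∣ ¬∣ = ∣2^⇒≡2^ e q′∣ λ q∣ → ¬∣ (subst (_∣ 2 ^ suc e) (*-comm 2 q′) (*-monoʳ-∣ 2 q∣))

2∤1+2* : ∀ i → ¬ 2 ∣ suc (2 * i)
2∤1+2* i 2∣ with ∣1⇒≡1 (∣m+n∣m⇒∣n (subst (2 ∣_) (+-comm 1 (2 * i)) 2∣) (m∣m*n i))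
... | ()

2∤* : ∀ {u v} → ¬ 2 ∣ u → ¬ 2 ∣ v → ¬ 2 ∣ u * v
2∤* {u} {v} ¬u ¬v = [ ¬u , ¬v ]′ ∘ euclidsLemma u v prime[2]

-- q is the period of j under multiplication by a modulo n. Meaningful for
-- a > 0 only, where a ^ t ∸ 1 is not truncated.

Period : (a n j q : ℕ) → Set
Period a n j q = ∀ t → (n ∣ (a ^ t ∸ 1) * j → q ∣ t) × (q ∣ t → n ∣ (a ^ t ∸ 1) * j)

period-1 : ∀ {a n j q} → Period a n j q → n ∣ (a ∸ 1) * j → q ≡ 1
period-1 {a} {n} {j} p n∣ = ∣1⇒≡1 (proj₁ (p 1) (subst (λ b → n ∣ (b ∸ 1) * j) (sym (^-identityʳ a)) n∣))

period-2^ : ∀ {a n j q} → Period a n j q → ∀ e →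
  n ∣ (a ^ 2 ^ suc e ∸ 1) * j → ¬ n ∣ (a ^ 2 ^ e ∸ 1) * j → q ≡ 2 ^ suc e
period-2^ p e n∣ ¬n∣ = ∣2^⇒≡2^ e (proj₁ (p _) n∣) (¬n∣ ∘ proj₂ (p _))

-- Periods are unique, so all f here agree; the quantification over f spares
-- a definition of the period as a function.

HasPeriods : (a n : ℕ) → List ℕ → Set
HasPeriods a n qs = ∀ f → (∀ j → Period a n j (f j)) → map f (upTo n) ↭ qs

-- The square is 1 + 2^(k+1) (w + 2^(k-1) w^2), and k ≥ 2 makes the second summand of the bracket
-- even. For k = 1 the bracket w + w^2 would always be even.
square-1+ : ∀ {k w} → 2 ≤ k → ¬ 2 ∣ w →
  ∃ λ v → ¬ 2 ∣ v × (1 + 2 ^ k * w) * (1 + 2 ^ k * w) ≡ 1 + 2 ^ suc k * v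
square-1+ {suc (suc k)} {w} (s≤s (s≤s _)) ¬2∣w =
  2 * (2 ^ k * w * w) + w , (λ 2∣ → ¬2∣w (∣m+n∣m⇒∣n 2∣ (m∣m*n (2 ^ k * w * w)))) , expand (2 ^ k) w
  where
  expand : ∀ p w → (1 + 2 * (2 * p) * w) * (1 + 2 * (2 * p) * w) ≡ 1 + 2 * (2 * (2 * p)) * (2 * (p * w * w) + w)
  expand = solve-∀

^-2^-suc : ∀ a e → a ^ 2 ^ suc e ≡ a ^ 2 ^ e * a ^ 2 ^ e
^-2^-suc a e = trans (cong (a ^_) (cong (2 ^ e +_) (+-identityʳ (2 ^ e)))) (^-distribˡ-+-* a (2 ^ e) (2 ^ e))

lift-2 : ∀ {b k w} → 2 ≤ k → ¬ 2 ∣ w → b ≡ 1 + 2 ^ k * w →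
  ∀ e → ∃ λ v → ¬ 2 ∣ v × b ^ 2 ^ e ≡ 1 + 2 ^ (e + k) * v
lift-2 {b} {w = w} 2≤k ¬2∣w eq zero = w , ¬2∣w , trans (^-identityʳ b) eq
lift-2 {b} {k} 2≤k ¬2∣w eq (suc e) with v , ¬2∣v , eq′ ← lift-2 2≤k ¬2∣w eq e
  with u , ¬2∣u , eq″ ← square-1+ (≤-trans 2≤k (m≤n+m k e)) ¬2∣v =
  u , ¬2∣u , trans (^-2^-suc b e) (trans (cong₂ _*_ eq′ eq′) eq″)

-- What the lifting of periods needs from a multiplier of either sign. Exponent 1 is kept apart in
-- `first`, which only asks that odd points move: for a near -1, a itself is not 1 + 2^k w with w
-- odd, and the exact power of two is available from a^2 on.
record Doubling (a k : ℕ) : Set where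
  field
    first : ∀ i → ¬ 2 ^ suc k ∣ (a ∸ 1) * suc (2 * i)
    later : ∀ e → ∃ λ w → ¬ 2 ∣ w × a ^ 2 ^ suc e ≡ 1 + 2 ^ (suc e + k) * w

  moves : ∀ d i → ¬ 2 ^ (suc d + k) ∣ (a ^ 2 ^ d ∸ 1) * suc (2 * i)
  moves zero i 2^∣ = first i (subst (λ b → 2 ^ suc k ∣ (b ∸ 1) * suc (2 * i)) (^-identityʳ a) 2^∣)
  moves (suc e) i 2^∣ with w , ¬2∣w , eq ← later e = 2∤* ¬2∣w (2∤1+2* i)
    (*-cancelˡ-∣ (2 ^ (suc e + k)) {{m^n≢0 2 (suc e + k)}}
      (subst₂ _∣_ (*-comm 2 (2 ^ (suc e + k)))
        (trans (cong (λ b → (b ∸ 1) * suc (2 * i)) eq) (*-assoc (2 ^ (suc e + k)) w (suc (2 * i)))) 2^∣))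

  fixes : ∀ d j → 2 ^ (suc d + k) ∣ (a ^ 2 ^ suc d ∸ 1) * j
  fixes d j with w , _ , eq ← later d =
    ∣m⇒∣m*n j (subst (λ b → 2 ^ (suc d + k) ∣ b ∸ 1) (sym eq) (m∣m*n w))

map-const : ∀ {A : Set} {g : ℕ → A} {c} n → (∀ {i} → i < n → g i ≡ c) → map g (upTo n) ≡ replicate n c
map-const {g = g} n eq = trans (map-upTo g n) (go g n eq)
  where
  go : ∀ {A : Set} (g : ℕ → A) {c} n → (∀ {i} → i < n → g i ≡ c) → applyUpTo g n ≡ replicate n c
  go g zero eq = refl
  go g (suc n) eq = cong₂ _∷_ (eq z<s) (go (g ∘ suc) n (eq ∘ s<s))

-- Passing from modulus 2^(j+k) to 2^(j+k+1) adds 2^(j+k) odd residues, each of period 2^(j+1).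
levels : ℕ → ℕ → List ℕ
levels k d = concatMap (λ j → replicate (2 ^ (j + k)) (2 ^ suc j)) (upTo d)

-- From modulus h to 2h, an even j behaves like j/2 modulo h, and the odd
-- ones contribute a new level.

hasPeriods-lift : ∀ {a k qs} → Doubling a k → HasPeriods a (2 ^ k) qs → ∀ d →
  HasPeriods a (2 ^ (d + k)) (qs ++ levels k d)
hasPeriods-lift {qs = qs} D base zero f p = ↭-trans (base f p) (↭-reflexive (sym (++-identityʳ qs)))
hasPeriods-lift {a} {k} {qs} D base (suc d) f p = begin
  map f (upTo (2 * h))                                          ↭⟨ map⁺ f (upTo-parity h) ⟩
  map f (map (2 *_) (upTo h) ++ map (λ i → suc (2 * i)) (upTo h))
    ≡⟨ map-++ f (map (2 *_) (upTo h)) _ ⟩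
  map f (map (2 *_) (upTo h)) ++ map f (map (λ i → suc (2 * i)) (upTo h))
    ≡⟨ cong₂ _++_ (map-∘ (upTo h)) (map-∘ (upTo h)) ⟨
  map (λ i → f (2 * i)) (upTo h) ++ map (λ i → f (suc (2 * i))) (upTo h)
    ≡⟨ cong (map (λ i → f (2 * i)) (upTo h) ++_) (map-const h (λ {i} _ → odd i)) ⟩
  map (λ i → f (2 * i)) (upTo h) ++ F d
    ↭⟨ ++⁺ʳ (F d) (hasPeriods-lift {qs = qs} D base d (λ i → f (2 * i)) even) ⟩
  (qs ++ concatMap F (upTo d)) ++ F d                           ≡⟨ ++-assoc qs _ _ ⟩
  qs ++ concatMap F (upTo d) ++ F d                             ≡⟨ cong (qs ++_) (concatMap-upTo-suc F d) ⟨
  qs ++ concatMap F (upTo (suc d))                              ∎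
  where
  open PermutationReasoning
  open Doubling D
  h = 2 ^ (d + k)
  F : ℕ → List ℕ
  F j = replicate (2 ^ (j + k)) (2 ^ suc j)
  odd : ∀ i → f (suc (2 * i)) ≡ 2 ^ suc d
  odd i = period-2^ (p (suc (2 * i))) d (fixes d _) (moves d i)
  swap-2 : ∀ c i → c * (2 * i) ≡ 2 * (c * i)
  swap-2 = solve-∀
  even : ∀ i → Period a h i (f (2 * i))
  even i t =
    (λ h∣ → proj₁ (p (2 * i) t) (subst (2 * h ∣_) (sym (swap-2 (a ^ t ∸ 1) i)) (*-monoʳ-∣ 2 h∣))) ,
    (λ q∣ → *-cancelˡ-∣ 2 (subst (2 * h ∣_) (swap-2 (a ^ t ∸ 1) i) (proj₂ (p (2 * i) t) q∣)))

doubling⁺ : ∀ {a k w} → 2 ≤ k → ¬ 2 ∣ w → a ≡ 1 + 2 ^ k * w → Doubling a k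
doubling⁺ {a} {k} {w} 2≤k ¬2∣w eq = record
  { first = λ i 2^∣ → 2∤* ¬2∣w (2∤1+2* i) (*-cancelˡ-∣ (2 ^ k) {{m^n≢0 2 k}}
      (subst₂ _∣_ (*-comm 2 (2 ^ k))
        (trans (cong (λ b → (b ∸ 1) * suc (2 * i)) eq) (*-assoc (2 ^ k) w (suc (2 * i)))) 2^∣))
  ; later = λ e → lift-2 2≤k ¬2∣w eq (suc e) }

-- For a = 1 + 2v this is a² - 1 = (a - 1)(a + 1).

square-near-−1 : ∀ h v w → suc v ≡ h * w →
  (1 + 2 * v) * (1 + 2 * v) ≡ 1 + 2 * (2 * h) * (v * w)
square-near-−1 h v w eq = begin
  (1 + 2 * v) * (1 + 2 * v)  ≡⟨ expand v ⟩
  1 + 4 * (v * suc v)        ≡⟨ cong (λ s → 1 + 4 * (v * s)) eq ⟩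
  1 + 4 * (v * (h * w))      ≡⟨ regroup v h w ⟩
  1 + 2 * (2 * h) * (v * w)  ∎
  where
  open ≡-Reasoning
  expand : ∀ v → (1 + 2 * v) * (1 + 2 * v) ≡ 1 + 4 * (v * suc v)
  expand = solve-∀
  regroup : ∀ v h w → 1 + 4 * (v * (h * w)) ≡ 1 + 2 * (2 * h) * (v * w)
  regroup = solve-∀

-- As v + 1 is even, v is odd and a - 1 = 2v has a single factor 2; an odd point therefore moves
-- already modulo 4, which divides 2^(k+2). Further, a^2 = 1 + 2^(k+2) v w with v w odd, and from
-- there the squaring argument near 1 takes over.
doubling⁻ : ∀ {k v w} → 1 ≤ k → ¬ 2 ∣ w → suc v ≡ 2 ^ k * w → Doubling (1 + 2 * v) (suc k)
doubling⁻ {suc k} {v} {w} _ ¬2∣w eq = record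
  { first = λ i 2^∣ → 2∤* ¬2∣v (2∤1+2* i) (*-cancelˡ-∣ 2 (∣-trans (4∣4* (2 ^ k))
      (subst (2 ^ suc (suc (suc k)) ∣_) (*-assoc 2 v (suc (2 * i))) 2^∣)))
  ; later = later′ }
  where
  4∣4* : ∀ m → 2 * 2 ∣ 2 * (2 * (2 * m))
  4∣4* m = *-monoʳ-∣ {m = 2} 2 (m∣m*n (2 * m))
  ¬2∣v : ¬ 2 ∣ v
  ¬2∣v 2∣v with ∣1⇒≡1 (∣m+n∣m⇒∣n (subst (2 ∣_) (trans (sym (trans eq (*-assoc 2 (2 ^ k) w))) (+-comm 1 v))
                       (m∣m*n (2 ^ k * w))) 2∣v)
  ... | ()
  later′ : ∀ e → ∃ λ u → ¬ 2 ∣ u × (1 + 2 * v) ^ 2 ^ suc e ≡ 1 + 2 ^ (suc e + suc (suc k)) * u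
  later′ e with u , ¬2∣u , eq′ ← lift-2 {k = suc (suc (suc k))} (s≤s (s≤s z≤n)) (2∤* ¬2∣v ¬2∣w)
                                   (square-near-−1 (2 ^ suc k) v w eq) e =
    u , ¬2∣u , (begin
      a ^ 2 ^ suc e         ≡⟨ ^-*-assoc a 2 (2 ^ e) ⟨
      (a ^ 2) ^ 2 ^ e       ≡⟨ cong (λ b → (a * b) ^ 2 ^ e) (*-identityʳ a) ⟩
      (a * a) ^ 2 ^ e       ≡⟨ eq′ ⟩
      1 + 2 ^ (e + suc (suc (suc k))) * u ≡⟨ cong (λ l → 1 + 2 ^ l * u) (+-suc e (suc (suc k))) ⟩
      1 + 2 ^ (suc e + suc (suc k)) * u   ∎)
    where
    open ≡-Reasoning
    a = 1 + 2 * v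

hasPeriods-1 : ∀ {n w} → HasPeriods (1 + n * w) n (replicate n 1)
hasPeriods-1 {n} {w} f p = ↭-reflexive (map-const n λ {i} _ →
  period-1 (p i) (∣m⇒∣m*n i (m∣m*n w)))

-- Here a is -1 modulo 2h with h = g + 1, so only 0 and h are fixed, and each half of the residues
-- contributes one 1 and g twos. The tests come down to h: 2h divides (a - 1) j = 2vj iff h divides
-- vj, iff h divides j, since v is -1 modulo h.
hasPeriods-−1 : ∀ {g v w} → suc v ≡ suc g * w →
  HasPeriods (1 + 2 * v) (2 * suc g) (1 ∷ 1 ∷ replicate (g * 2) 2)
hasPeriods-−1 {g} {v} {w} eq f p = begin
  map f (upTo (2 * h))                            ≡⟨ cong (λ l → map f (upTo (h + l))) (+-identityʳ h) ⟩
  map f (upTo (h + h))                            ≡⟨ cong (map f) (upTo-+ h h) ⟩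
  map f (upTo h ++ map (h +_) (upTo h))           ≡⟨ map-++ f (upTo h) _ ⟩
  map f (upTo h) ++ map f (map (h +_) (upTo h))   ≡⟨ cong (map f (upTo h) ++_) (map-∘ (upTo h)) ⟨
  map f (upTo h) ++ map (λ j → f (h + j)) (upTo h)
    ≡⟨ cong₂ _++_ (half f (f-1 (h ∣0)) (λ i<g → f-2 (>⇒∤ (s<s i<g))))
                  (half (λ j → f (h + j)) (f-1 (∣m∣n⇒∣m+n ∣-refl (h ∣0)))
                        (λ i<g → f-2 (λ h∣ → >⇒∤ (s<s i<g) (∣m+n∣m⇒∣n h∣ ∣-refl)))) ⟩
  (1 ∷ replicate g 2) ++ 1 ∷ replicate g 2        ↭⟨ prep 1 (shift 1 (replicate g 2) (replicate g 2)) ⟩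
  1 ∷ 1 ∷ replicate g 2 ++ replicate g 2          ≡⟨ cong (λ l → 1 ∷ 1 ∷ l) (replicate-+ g g) ⟨
  1 ∷ 1 ∷ replicate (g + g) 2                     ≡⟨ cong (λ l → 1 ∷ 1 ∷ replicate l 2) (g+g g) ⟩
  1 ∷ 1 ∷ replicate (g * 2) 2                     ∎
  where
  open PermutationReasoning
  h = suc g
  a = 1 + 2 * v
  g+g : ∀ g → g + g ≡ g * 2
  g+g = solve-∀
  half : ∀ (f : ℕ → ℕ) → f 0 ≡ 1 → (∀ {i} → i < g → f (suc i) ≡ 2) →
         map f (upTo h) ≡ 1 ∷ replicate g 2
  half f f0 fs = cong₂ _∷_ f0
    (trans (trans (map-applyUpTo suc f g) (sym (map-upTo (f ∘ suc) g))) (map-const g fs))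
  f-1 : ∀ {j} → h ∣ j → f j ≡ 1
  f-1 {j} h∣j = period-1 (p j) (subst (2 * h ∣_) (sym (*-assoc 2 v j)) (*-monoʳ-∣ 2 (∣n⇒∣m*n v h∣j)))
  f-2 : ∀ {j} → ¬ h ∣ j → f j ≡ 2
  f-2 {j} ¬h∣j = period-2^ (p j) 0
    (∣m⇒∣m*n j (subst (λ b → 2 * h ∣ b ∸ 1)
      (trans (sym (square-near-−1 h v w eq)) (cong (a *_) (sym (*-identityʳ a))))
      (∣m⇒∣m*n (v * w) (∣n⇒∣m*n 2 ∣-refl))))
    λ 2h∣ → ¬h∣j (∣m+n∣m⇒∣n {m = v * j}
      (subst (h ∣_) (trans (cong (_* j) (sym eq)) (+-comm j (v * j))) (∣m⇒∣m*n j (m∣m*n w)))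
      (*-cancelˡ-∣ 2 (subst (2 * h ∣_)
        (trans (cong (λ b → (b ∸ 1) * j) (*-identityʳ a)) (*-assoc 2 v j)) 2h∣)))

inflate-concatMap : ∀ {A : Set} (F : A → List ℕ) is → inflate (concatMap F is) ≡ concatMap (inflate ∘ F) is
inflate-concatMap F [] = refl
inflate-concatMap F (i ∷ is) =
  trans (inflate-++ (F i) (concatMap F is)) (cong (inflate (F i) ++_) (inflate-concatMap F is))

-- x_2^(2^k) x_4^(2^k) ⋯ with d factors.

tower : ℕ → ℕ → Monomial
tower k d = concatMap (λ j → replicate (2 ^ k) (2 ^ suc j)) (upTo d)

-- 2^k cycles of length 2^(j+1) cover 2^(j+k+1) points. The number of cycles is the same at every
-- level because the odd residues and their period double together.
inflate-tower : ∀ k d → inflate (tower k d) ≡ levels (suc k) d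
inflate-tower k d = trans (inflate-concatMap _ (upTo d)) (concatMap-cong level (upTo d))
  where
  level : ∀ j → inflate (replicate (2 ^ k) (2 ^ suc j)) ≡ replicate (2 ^ (j + suc k)) (2 ^ suc j)
  level j = trans (inflate-replicate (2 ^ k) (2 ^ suc j)) (cong (λ l → replicate l (2 ^ suc j))
    (trans (sym (^-distribˡ-+-* 2 k (suc j))) (cong (2 ^_) (k+1+j k j))))
    where
    k+1+j : ∀ k j → k + suc j ≡ j + suc k
    k+1+j = solve-∀

tower-positive : ∀ k d → All (0 <_) (tower k d)
tower-positive k d = All.concat⁺ (All.map⁺
  (All.universal (λ j → All.replicate⁺ (2 ^ k) (m^n>0 2 (suc j))) (upTo d)))

-- From periods to the cycle type of a multiplication

map-toℕ-allFin : ∀ n → map toℕ (allFin n) ≡ upTo n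
map-toℕ-allFin n = trans (map-tabulate id toℕ) (go id n)
  where
  go : ∀ (g : ℕ → ℕ) n → tabulate {n = n} (g ∘ toℕ) ≡ applyUpTo g n
  go g zero = refl
  go g (suc n) = cong (g 0 ∷_) (go (g ∘ suc) n)

-- `T` is a proposed cycle type; testing it after inflation, against the cycle length at each point,
-- is enough because `inflate` cancels on positive lists.
ctype-from-lengths : ∀ {N} (π : Permutation′ N) (g : ℕ → ℕ) →
  (∀ j → ∣ cycleOf π j ∣ ≡ g (toℕ j)) → ∀ {T} → All (0 <_) T → map g (upTo N) ↭ inflate T →
  ∃ λ u → ctype π ≡ mono u × u ↭ T
ctype-from-lengths {N} π g eq {T} T>0 g↭ with u , ctype≡u , u↭ ← ctype-mono π =
  u , ctype≡u , ↭-trans u↭ (inflate-cancel (All.map proj₁ (cycle-lengths π)) T>0 (begin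
    inflate (map ∣_∣ (cycles π))            ↭⟨ inflate-cycles π ⟩
    map (λ j → ∣ cycleOf π j ∣) (allFin N)  ≡⟨ map-cong eq (allFin N) ⟩
    map (λ j → g (toℕ j)) (allFin N)        ≡⟨ map-∘ (allFin N) ⟩
    map g (map toℕ (allFin N))              ≡⟨ cong (map g) (map-toℕ-allFin N) ⟩
    map g (upTo N)                          ↭⟨ g↭ ⟩
    inflate T                               ∎))
  where open PermutationReasoning

module _ (n : ℕ) .{{_ : NonZero n}} (a : ℕ) (1≤a : 1 ≤ a)
         (π : Permutation′ n) (π≗a : ∀ j → π ⟨$⟩ʳ j ≡ _·_ n (a mod n) j) where

  private
    f = π ⟨$⟩ʳ_

  fold-scale : ∀ j t → fold (j mod n) f t ≡ (a ^ t * j) mod n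
  fold-scale j zero = cong (_mod n) (sym (+-identityʳ j))
  fold-scale j (suc t) = begin
    f (fold (j mod n) f t)             ≡⟨ cong f (fold-scale j t) ⟩
    f ((a ^ t * j) mod n)              ≡⟨ π≗a ((a ^ t * j) mod n) ⟩
    _·_ n (a mod n) ((a ^ t * j) mod n) ≡⟨ mod-·-mod n a (a ^ t * j) ⟩
    (a * (a ^ t * j)) mod n            ≡⟨ cong (_mod n) (*-assoc a (a ^ t) j) ⟨
    (a ^ suc t * j) mod n              ∎
    where open ≡-Reasoning

  fixed⇒∣ : ∀ {b} j → 0 < b → b * j % n ≡ j % n → n ∣ (b ∸ 1) * j
  fixed⇒∣ {suc b} j _ eq = ∣m+n∣m⇒∣n (divides (suc b * j / n) (+-cancelˡ-≡ (j % n) _ _ (begin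
    j % n + (j / n * n + b * j)              ≡⟨ +-assoc (j % n) (j / n * n) (b * j) ⟨
    j % n + j / n * n + b * j                ≡⟨ cong (_+ b * j) (m≡m%n+[m/n]*n j n) ⟨
    suc b * j                                ≡⟨ m≡m%n+[m/n]*n (suc b * j) n ⟩
    suc b * j % n + suc b * j / n * n        ≡⟨ cong (_+ suc b * j / n * n) eq ⟩
    j % n + suc b * j / n * n                ∎))) (n∣m*n (j / n))
    where open ≡-Reasoning

  ∣⇒fixed : ∀ {b} j → 0 < b → n ∣ (b ∸ 1) * j → b * j % n ≡ j % n
  ∣⇒fixed {suc b} j _ (divides k eq) = trans (cong (λ m → (j + m) % n) eq) ([m+kn]%n≡m%n j k n)

  scale-period : ∀ j → Period a n j ∣ cycleOf π (j mod n) ∣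
  scale-period j t =
    (λ n∣ → proj₁ period (trans (fold-scale j t) (mod-cong n (∣⇒fixed j 0<aᵗ n∣)))) ,
    (λ q∣ → fixed⇒∣ j 0<aᵗ (begin
      a ^ t * j % n                 ≡⟨ toℕ-mod n (a ^ t * j) ⟨
      toℕ ((a ^ t * j) mod n)       ≡⟨ cong toℕ (fold-scale j t) ⟨
      toℕ (fold (j mod n) f t)      ≡⟨ cong toℕ (proj₂ period q∣) ⟩
      toℕ (j mod n)                 ≡⟨ toℕ-mod n j ⟩
      j % n                         ∎))
    where
    open ≡-Reasoning
    0<aᵗ = m^n>0 a {{>-nonZero 1≤a}} t
    period = ∣cycleOf∣-isPeriod π (j mod n) t

  ctype-scale : ∀ {T} → All (0 <_) T → HasPeriods a n (inflate T) → ∃ λ u → ctype π ≡ mono u × u ↭ T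
  ctype-scale T>0 periods = ctype-from-lengths π (λ j → ∣ cycleOf π (j mod n) ∣)
    (λ j → cong (λ i → ∣ cycleOf π i ∣) (sym (mod-toℕ n j))) T>0 (periods _ scale-period)

-- Polynomials

coeff-++ : ∀ p q u → coeff (p ++ q) u ≡ coeff p u +ℚ coeff q u
coeff-++ [] q u = sym (ℚ.+-identityˡ _)
coeff-++ ((c , v) ∷ p) q u with v ≟ᵐ u
... | yes _ = trans (cong (c +ℚ_) (coeff-++ p q u)) (sym (ℚ.+-assoc c _ _))
... | no  _ = coeff-++ p q u

coeff-const-* : ∀ c p u → coeff (const c *ₚ p) u ≡ c *ℚ coeff p u
coeff-const-* c p u = trans (cong (λ q → coeff q u) (++-identityʳ (map (λ (d , v) → (c *ℚ d , v)) p))) (go p)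
  where
  go : ∀ p → coeff (map (λ (d , v) → (c *ℚ d , v)) p) u ≡ c *ℚ coeff p u
  go [] = sym (ℚ.*-zeroʳ c)
  go ((d , v) ∷ p) with v ≟ᵐ u
  ... | yes _ = trans (cong (c *ℚ d +ℚ_) (go p)) (sym (ℚ.*-distribˡ-+ c d _))
  ... | no  _ = go p

-- _≈ₚ_ unfolds to a statement about coefficients, from which Agda cannot
-- recover the two polynomials; the record keeps them.

infix 4 _≋_
record _≋_ (p q : Poly) : Set where
  constructor coeffwise
  field
    coeff-≡ : p ≈ₚ q

open _≋_

≋-setoid : Setoid _ _
≋-setoid = record { Carrier = Poly ; _≈_ = _≋_ ; isEquivalence = record
  { refl  = coeffwise λ _ → refl
  ; sym   = λ e → coeffwise λ u → sym (coeff-≡ e u)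
  ; trans = λ e e′ → coeffwise λ u → trans (coeff-≡ e u) (coeff-≡ e′ u) } }

open Setoid ≋-setoid using ()
  renaming (refl to ≋-refl; trans to ≋-trans; reflexive to ≋-reflexive)

+ₚ-cong : ∀ {p p′ q q′} → p ≋ p′ → q ≋ q′ → p +ₚ q ≋ p′ +ₚ q′
+ₚ-cong {p} {p′} {q} {q′} e e′ = coeffwise λ u →
  trans (coeff-++ p q u) (trans (cong₂ _+ℚ_ (coeff-≡ e u) (coeff-≡ e′ u)) (sym (coeff-++ p′ q′ u)))

+ₚ-comm : ∀ p q → p +ₚ q ≋ q +ₚ p
+ₚ-comm p q = coeffwise λ u →
  trans (coeff-++ p q u) (trans (ℚ.+-comm (coeff p u) (coeff q u)) (sym (coeff-++ q p u)))

const-*-cong : ∀ c {p q} → p ≋ q → const c *ₚ p ≋ const c *ₚ q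
const-*-cong c {p} {q} e = coeffwise λ u →
  trans (coeff-const-* c p u) (trans (cong (c *ℚ_) (coeff-≡ e u)) (sym (coeff-const-* c q u)))

sumOver-↭ : ∀ {A : Set} (f : A → Poly) {is js} → is ↭ js → sumOver is f ≋ sumOver js f
sumOver-↭ f Perm.refl = ≋-refl
sumOver-↭ f (Perm.prep i r) = +ₚ-cong (≋-refl {f i}) (sumOver-↭ f r)
sumOver-↭ f (Perm.swap {is} {js} i j r) = begin
  f i ++ f j ++ sumOver is f     ≡⟨ ++-assoc (f i) (f j) _ ⟨
  (f i ++ f j) ++ sumOver is f   ≈⟨ +ₚ-cong (+ₚ-comm (f i) (f j)) (sumOver-↭ f r) ⟩
  (f j ++ f i) ++ sumOver js f   ≡⟨ ++-assoc (f j) (f i) _ ⟩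
  f j ++ f i ++ sumOver js f     ∎
  where open SetoidReasoning ≋-setoid
sumOver-↭ f (Perm.trans r s) = ≋-trans (sumOver-↭ f r) (sumOver-↭ f s)

sumOver-++ : ∀ {A : Set} (f : A → Poly) is js → sumOver (is ++ js) f ≡ sumOver is f +ₚ sumOver js f
sumOver-++ = concatMap-++

sumOver-map : ∀ {A B : Set} (f : B → Poly) (g : A → B) is → sumOver (map g is) f ≡ sumOver is (f ∘ g)
sumOver-map f g is = concatMap-map f g is

term : ℕ → Monomial → Poly
term k u = (ℤ.+ k /ℚ 1 , u) ∷ []

nat-*-mono : ∀ k u → nat k *ₚ mono u ≡ term k u
nat-*-mono k u = cong (λ c → (c , u) ∷ []) (ℚ.*-identityʳ (ℤ.+ k /ℚ 1))

term-*-mono : ∀ k u v → term k u *ₚ mono v ≡ term k (u ++ v)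
term-*-mono k u v = cong (λ c → (c , u ++ v) ∷ []) (ℚ.*-identityʳ (ℤ.+ k /ℚ 1))

suc-/1 : ∀ k → ℤ.+ suc k /ℚ 1 ≡ 1ℚ +ℚ (ℤ.+ k /ℚ 1)
suc-/1 k = ℚ.toℚᵘ-injective (begin
  toℚᵘ (ℤ.+ suc k /ℚ 1)                   ≈⟨ ℚ.toℚᵘ-fromℚᵘ (ℚᵘ.mkℚᵘ (ℤ.+ suc k) 0) ⟩
  ℚᵘ.mkℚᵘ (ℤ.+ suc k) 0
    ≈⟨ ℚᵘ.≃-reflexive (cong (λ z → ℚᵘ.mkℚᵘ (ℤ.+ 1 ℤ.+ z) 0) (sym (ℤ.*-identityʳ (ℤ.+ k)))) ⟩
  ℚᵘ.1ℚᵘ ℚᵘ.+ ℚᵘ.mkℚᵘ (ℤ.+ k) 0           ≈⟨ ℚᵘ.+-congʳ ℚᵘ.1ℚᵘ (ℚ.toℚᵘ-fromℚᵘ (ℚᵘ.mkℚᵘ (ℤ.+ k) 0)) ⟨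
  toℚᵘ 1ℚ ℚᵘ.+ toℚᵘ (ℤ.+ k /ℚ 1)          ≈⟨ ℚ.toℚᵘ-homo-+ 1ℚ (ℤ.+ k /ℚ 1) ⟨
  toℚᵘ (1ℚ +ℚ (ℤ.+ k /ℚ 1))               ∎)
  where open SetoidReasoning ℚᵘ.≃-setoid

mono-cong : ∀ {u v} → u ↭ v → mono u ≋ mono v
mono-cong {u} {v} r = coeffwise go
  where
  go : mono u ≈ₚ mono v
  go w with u ≟ᵐ w | v ≟ᵐ w
  ... | yes _ | yes _ = refl
  ... | no  _ | no  _ = refl
  ... | yes s | no ¬s = ⊥-elim (¬s (↭-trans (↭-sym r) s))
  ... | no ¬s | yes s = ⊥-elim (¬s (↭-trans r s))

coeff-hit : ∀ c {u v} p → u ↭ v → coeff ((c , u) ∷ p) v ≡ c +ℚ coeff p v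
coeff-hit c {u} {v} p r with u ≟ᵐ v
... | yes _ = refl
... | no ¬r = ⊥-elim (¬r r)

coeff-miss : ∀ c {u v} p → ¬ (u ↭ v) → coeff ((c , u) ∷ p) v ≡ coeff p v
coeff-miss c {u} {v} p ¬r with u ≟ᵐ v
... | yes r = ⊥-elim (¬r r)
... | no  _ = refl

like-terms : ∀ c d u p → (c , u) ∷ (d , u) ∷ p ≋ (c +ℚ d , u) ∷ p
like-terms c d u p = coeffwise λ v → go v (u ≟ᵐ v)
  where
  go : ∀ v → Dec (u ↭ v) → coeff ((c , u) ∷ (d , u) ∷ p) v ≡ coeff ((c +ℚ d , u) ∷ p) v
  go v (yes r) = trans (coeff-hit c _ r) (trans (cong (c +ℚ_) (coeff-hit d p r))
    (trans (sym (ℚ.+-assoc c d _)) (sym (coeff-hit (c +ℚ d) p r))))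
  go v (no ¬r) = trans (coeff-miss c _ ¬r) (trans (coeff-miss d p ¬r) (sym (coeff-miss (c +ℚ d) p ¬r)))

sumOver-const : ∀ {A : Set} {f : A → Poly} {T} → (∀ i → f i ≋ mono T) → ∀ is →
                sumOver is f ≋ term (length is) T
-- The empty sum is `[]`, whereas `term 0 T` is a listed term with coefficient 0; they agree only
-- coefficientwise.
sumOver-const {T = T} e [] = coeffwise λ v → go v (T ≟ᵐ v)
  where
  go : ∀ v → Dec (T ↭ v) → 0ℚ ≡ coeff (term 0 T) v
  go v (yes r) = sym (coeff-hit 0ℚ [] r)
  go v (no ¬r) = sym (coeff-miss 0ℚ [] ¬r)
sumOver-const {f = f} {T} e (i ∷ is) = begin
  f i +ₚ sumOver is f                      ≈⟨ +ₚ-cong {f i} {mono T} (e i) (sumOver-const {f = f} e is) ⟩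
  mono T +ₚ term (length is) T             ≈⟨ like-terms 1ℚ (ℤ.+ length is /ℚ 1) T [] ⟩
  (1ℚ +ℚ (ℤ.+ length is /ℚ 1) , T) ∷ []    ≡⟨ cong (λ c → (c , T) ∷ []) (suc-/1 (length is)) ⟨
  term (suc (length is)) T                 ∎
  where open SetoidReasoning ≋-setoid

sumOver-upTo-suc : ∀ (f : ℕ → Poly) n → sumOver (upTo (suc n)) f ≡ sumOver (upTo n) f +ₚ f n
sumOver-upTo-suc = concatMap-upTo-suc

sumOver-parity : ∀ (f : ℕ → Poly) h → sumOver (upTo (2 * h)) f ≋
  sumOver (upTo h) (λ i → f (2 * i)) +ₚ sumOver (upTo h) (λ i → f (suc (2 * i)))
sumOver-parity f h = ≋-trans (sumOver-↭ f (upTo-parity h)) (≋-reflexive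
  (trans (sumOver-++ f (map (2 *_) (upTo h)) _)
         (cong₂ _+ₚ_ (sumOver-map f (2 *_) (upTo h)) (sumOver-map f _ (upTo h)))))

-- The numbers b < 2^r (or 0 < b ≤ 2^r) are grouped by their 2-adic
-- valuation s = r - 1 - t; each group has 2^t elements.

private
  odd-part : ∀ (f : ℕ → Poly) {r} {T : ℕ → Monomial} →
    (∀ s t i → s + suc t ≡ suc r → f (2 ^ s * suc (2 * i)) ≋ mono (T t)) →
    sumOver (upTo (2 ^ r)) (λ i → f (suc (2 * i))) ≋ term (2 ^ r) (T r)
  odd-part f {r} {T} e = subst
    (λ k → sumOver (upTo (2 ^ r)) (λ i → f (suc (2 * i))) ≋ term k (T r)) (length-upTo (2 ^ r))
    (sumOver-const
      (λ i → subst (λ b → f b ≋ mono (T r)) (+-identityʳ (suc (2 * i))) (e 0 r i refl))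
      (upTo (2 ^ r)))

  halve : ∀ (f : ℕ → Poly) {r} {T : ℕ → Monomial} →
    (∀ s t i → s + suc t ≡ suc r → f (2 ^ s * suc (2 * i)) ≋ mono (T t)) →
    ∀ s t i → s + suc t ≡ r → f (2 * (2 ^ s * suc (2 * i))) ≋ mono (T t)
  halve f {T = T} e s t i eq =
    subst (λ b → f b ≋ mono (T t)) (*-assoc 2 (2 ^ s) (suc (2 * i))) (e (suc s) t i (cong suc eq))

-- In the step from r to r + 1, halving an even b lowers s and keeps t, so the same `T` serves for
-- the smaller range; the odd b form the new group t = r.
valuation-sum : ∀ r (f : ℕ → Poly) {T₀} {T : ℕ → Monomial} → f 0 ≋ mono T₀ →
  (∀ s t i → s + suc t ≡ r → f (2 ^ s * suc (2 * i)) ≋ mono (T t)) →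
  sumOver (upTo (2 ^ r)) f ≋ mono T₀ +ₚ sumOver (upTo r) (λ t → term (2 ^ t) (T t))
valuation-sum zero f {T₀} e₀ e = +ₚ-cong {f 0} {mono T₀} e₀ (≋-refl {[]})
valuation-sum (suc r) f {T₀} {T} e₀ e = begin
  sumOver (upTo (2 * 2 ^ r)) f                     ≈⟨ sumOver-parity f (2 ^ r) ⟩
  sumOver (upTo (2 ^ r)) (λ i → f (2 * i)) +ₚ sumOver (upTo (2 ^ r)) (λ i → f (suc (2 * i)))
    ≈⟨ +ₚ-cong {sumOver (upTo (2 ^ r)) (λ i → f (2 * i))}
         (valuation-sum r (λ i → f (2 * i)) {T = T} e₀ (halve f {T = T} e)) (odd-part f {T = T} e) ⟩
  (mono T₀ +ₚ sumOver (upTo r) S) +ₚ S r           ≡⟨ ++-assoc (mono T₀) (sumOver (upTo r) S) (S r) ⟩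
  mono T₀ +ₚ (sumOver (upTo r) S +ₚ S r)           ≡⟨ cong (mono T₀ +ₚ_) (sumOver-upTo-suc S r) ⟨
  mono T₀ +ₚ sumOver (upTo (suc r)) S              ∎
  where
  open SetoidReasoning ≋-setoid
  S : ℕ → Poly
  S t = term (2 ^ t) (T t)

-- Halving the even members of 0 < b ≤ 2^r gives the same kind of range. The exceptional member is
-- now 2^r, the only one whose valuation is not below r.
valuation-sum′ : ∀ r (f : ℕ → Poly) {T₀} {T : ℕ → Monomial} → f (2 ^ r) ≋ mono T₀ →
  (∀ s t i → s + suc t ≡ r → f (2 ^ s * suc (2 * i)) ≋ mono (T t)) →
  sumOver (upTo (2 ^ r)) (f ∘ suc) ≋ mono T₀ +ₚ sumOver (upTo r) (λ t → term (2 ^ t) (T t))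
valuation-sum′ zero f {T₀} e₀ e = +ₚ-cong {f 1} {mono T₀} e₀ (≋-refl {[]})
valuation-sum′ (suc r) f {T₀} {T} e₀ e = begin
  sumOver (upTo (2 * 2 ^ r)) (f ∘ suc)             ≈⟨ sumOver-parity (f ∘ suc) (2 ^ r) ⟩
  sumOver (upTo (2 ^ r)) (λ i → f (suc (2 * i))) +ₚ sumOver (upTo (2 ^ r)) (λ i → f (suc (suc (2 * i))))
    ≈⟨ +ₚ-comm (sumOver (upTo (2 ^ r)) (λ i → f (suc (2 * i)))) _ ⟩
  sumOver (upTo (2 ^ r)) (λ i → f (suc (suc (2 * i)))) +ₚ sumOver (upTo (2 ^ r)) (λ i → f (suc (2 * i)))
    ≡⟨ cong (_+ₚ sumOver (upTo (2 ^ r)) (λ i → f (suc (2 * i))))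
         (concatMap-cong (λ i → cong f (sym (*-suc 2 i))) (upTo (2 ^ r))) ⟩
  sumOver (upTo (2 ^ r)) (λ i → f (2 * suc i)) +ₚ sumOver (upTo (2 ^ r)) (λ i → f (suc (2 * i)))
    ≈⟨ +ₚ-cong {sumOver (upTo (2 ^ r)) (λ i → f (2 * suc i))}
         (valuation-sum′ r (λ i → f (2 * i)) {T = T} e₀ (halve f {T = T} e)) (odd-part f {T = T} e) ⟩
  (mono T₀ +ₚ sumOver (upTo r) S) +ₚ S r           ≡⟨ ++-assoc (mono T₀) (sumOver (upTo r) S) (S r) ⟩
  mono T₀ +ₚ (sumOver (upTo r) S +ₚ S r)           ≡⟨ cong (mono T₀ +ₚ_) (sumOver-upTo-suc S r) ⟨
  mono T₀ +ₚ sumOver (upTo (suc r)) S              ∎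
  where
  open SetoidReasoning ≋-setoid
  S : ℕ → Poly
  S t = term (2 ^ t) (T t)

-- The cycle types of π_a modulo 2^(d+k+1) for a = 1 + 2^(k+1) w and for
-- a = -1 + 2^(k+1) w, with w odd.

T⁺ T⁻ : ℕ → ℕ → Monomial
T⁺ k d = replicate (2 ^ suc k) 1 ++ tower k d
T⁻ k d = 1 ∷ 1 ∷ replicate (2 ^ k ∸ 1) 2 ++ tower k d

T⁺-positive : ∀ k d → All (0 <_) (T⁺ k d)
T⁺-positive k d = All.++⁺ (All.replicate⁺ (2 ^ suc k) z<s) (tower-positive k d)

T⁻-positive : ∀ k d → All (0 <_) (T⁻ k d)
T⁻-positive k d = z<s ∷ z<s ∷ All.++⁺ (All.replicate⁺ (2 ^ k ∸ 1) z<s) (tower-positive k d)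

inflate-T⁺ : ∀ k d → inflate (T⁺ k d) ≡ replicate (2 ^ suc k) 1 ++ levels (suc k) d
inflate-T⁺ k d = trans (inflate-++ (replicate (2 ^ suc k) 1) (tower k d)) (cong₂ _++_
  (trans (inflate-replicate (2 ^ suc k) 1) (cong (λ l → replicate l 1) (*-identityʳ (2 ^ suc k))))
  (inflate-tower k d))

inflate-T⁻ : ∀ k d → inflate (T⁻ k d) ≡
  (1 ∷ 1 ∷ replicate ((2 ^ k ∸ 1) * 2) 2) ++ levels (suc k) d
inflate-T⁻ k d = cong (λ l → 1 ∷ 1 ∷ l) (trans
  (inflate-++ (replicate (2 ^ k ∸ 1) 2) (tower k d))
  (cong₂ _++_ (inflate-replicate (2 ^ k ∸ 1) 2) (inflate-tower k d)))

module _ {a k : ℕ} where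

  hasPeriods-T⁺ : ∀ {w} d → 1 ≤ k → ¬ 2 ∣ w → a ≡ 1 + 2 ^ suc k * w →
                  HasPeriods a (2 ^ (d + suc k)) (inflate (T⁺ k d))
  hasPeriods-T⁺ {w} d 1≤k ¬2∣w refl = subst (HasPeriods a (2 ^ (d + suc k))) (sym (inflate-T⁺ k d))
    (hasPeriods-lift {qs = replicate (2 ^ suc k) 1} (doubling⁺ {w = w} (s≤s 1≤k) ¬2∣w refl)
      (hasPeriods-1 {2 ^ suc k} {w}) d)

  hasPeriods-1-T⁺ : a ≡ 1 → HasPeriods a (2 ^ suc k) (inflate (T⁺ k 0))
  hasPeriods-1-T⁺ refl = subst₂ (λ b → HasPeriods b (2 ^ suc k)) (cong suc (*-zeroʳ (2 ^ suc k)))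
    (sym (trans (inflate-T⁺ k 0) (++-identityʳ _))) (hasPeriods-1 {2 ^ suc k} {0})

module _ {k v w : ℕ} (v+1≡ : suc v ≡ 2 ^ k * w) where

  hasPeriods-base : HasPeriods (1 + 2 * v) (2 ^ suc k) (1 ∷ 1 ∷ replicate ((2 ^ k ∸ 1) * 2) 2)
  hasPeriods-base = subst (λ h → HasPeriods (1 + 2 * v) (2 * h) (1 ∷ 1 ∷ replicate ((2 ^ k ∸ 1) * 2) 2)) 1+p
    (hasPeriods-−1 {2 ^ k ∸ 1} {v} {w} (trans v+1≡ (cong (_* w) (sym 1+p))))
    where
    1+p : suc (2 ^ k ∸ 1) ≡ 2 ^ k
    1+p = m+[n∸m]≡n (m^n>0 2 k)

  hasPeriods-T⁻ : ∀ d → 1 ≤ k → ¬ 2 ∣ w → HasPeriods (1 + 2 * v) (2 ^ (d + suc k)) (inflate (T⁻ k d))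
  hasPeriods-T⁻ d 1≤k ¬2∣w = subst (HasPeriods (1 + 2 * v) (2 ^ (d + suc k))) (sym (inflate-T⁻ k d))
    (hasPeriods-lift {qs = 1 ∷ 1 ∷ replicate ((2 ^ k ∸ 1) * 2) 2} (doubling⁻ 1≤k ¬2∣w v+1≡) hasPeriods-base d)

  hasPeriods-−1-T⁻ : HasPeriods (1 + 2 * v) (2 ^ suc k) (inflate (T⁻ k 0))
  hasPeriods-−1-T⁻ = subst (HasPeriods (1 + 2 * v) (2 ^ suc k))
    (sym (trans (inflate-T⁻ k 0) (++-identityʳ _))) hasPeriods-base

-- The sum over the units

odd∧∣2^⇒1 : ∀ e {d} → ¬ 2 ∣ d → d ∣ 2 ^ e → d ≡ 1
odd∧∣2^⇒1 zero _ d∣ = ∣1⇒≡1 d∣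
odd∧∣2^⇒1 (suc e) {d} ¬2∣d d∣ with d ∣? 2 ^ e
... | yes d∣′ = odd∧∣2^⇒1 e ¬2∣d d∣′
... | no ¬d∣ = ⊥-elim (¬2∣d (subst (2 ∣_) (sym (∣2^⇒≡2^ e d∣ ¬d∣)) (m∣m*n (2 ^ e))))

sumOver-mapMaybe : ∀ {A B : Set} (f : B → Poly) (g : A → Maybe B) is →
                   sumOver (mapMaybe g is) f ≡ sumOver is (maybe′ f [] ∘ g)
sumOver-mapMaybe f g [] = refl
sumOver-mapMaybe f g (i ∷ is) with g i
... | just b  = cong (f b +ₚ_) (sumOver-mapMaybe f g is)
... | nothing = sumOver-mapMaybe f g is

length-mapMaybe-just : ∀ {A B : Set} (g : A → Maybe B) → (∀ i → ∃ λ b → g i ≡ just b) → ∀ is →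
                       length (mapMaybe g is) ≡ length is
length-mapMaybe-just g some [] = refl
length-mapMaybe-just g some (i ∷ is) rewrite proj₂ (some i) = cong suc (length-mapMaybe-just g some is)

module _ (n : ℕ) .{{_ : NonZero n}} where

  residue-scale? : ℕ → Maybe _
  residue-scale? j = scale? n (j mod n)

  scales-upTo : scales n ≡ mapMaybe residue-scale? (upTo n)
  scales-upTo = begin
    mapMaybe (scale? n) (allFin n)
      ≡⟨ mapMaybe-cong (λ a → cong (scale? n) (mod-toℕ n a)) (allFin n) ⟨
    mapMaybe (residue-scale? ∘ toℕ) (allFin n)   ≡⟨ mapMaybe-map residue-scale? toℕ (allFin n) ⟨
    mapMaybe residue-scale? (map toℕ (allFin n)) ≡⟨ cong (mapMaybe residue-scale?) (map-toℕ-allFin n) ⟩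
    mapMaybe residue-scale? (upTo n)             ∎
    where open ≡-Reasoning

  scale?-just : ∀ a → Coprime (toℕ a) n →
                ∃ λ π → scale? n a ≡ just π × (∀ j → π ⟨$⟩ʳ j ≡ _·_ n a j)
  scale?-just a c with coprime? (toℕ a) n
  ... | yes c′ = scale n a c′ , refl , λ _ → refl
  ... | no ¬c  = ⊥-elim (¬c c)

  scale?-nothing : ∀ a → ¬ Coprime (toℕ a) n → scale? n a ≡ nothing
  scale?-nothing a ¬c with coprime? (toℕ a) n
  ... | yes c = ⊥-elim (¬c c)
  ... | no _  = refl

  -- Zero for a residue that is not a unit. Indexing by natural numbers lets the sum over the group
  -- be split by arithmetic on the index.
  residue-ctype : ℕ → Poly
  residue-ctype = maybe′ ctype [] ∘ residue-scale?

  residue-ctype-≋ : ∀ {a T} → 1 ≤ a → Coprime (toℕ (a mod n)) n → All (0 <_) T →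
                    HasPeriods a n (inflate T) → residue-ctype a ≋ mono T
  residue-ctype-≋ {a} {T} 1≤a co T>0 periods =
    let π , eq , π≗a    = scale?-just (a mod n) co
        u , ctype≡u , r = ctype-scale n a 1≤a π π≗a T>0 periods
    in ≋-trans (≋-reflexive (trans (cong (maybe′ ctype []) eq) ctype≡u)) (mono-cong r)

module _ (l : ℕ) where

  private
    n = 2 ^ suc l
    instance
      n≢0 : NonZero n
      n≢0 = m^n≢0 2 (suc l)

  odd-coprime : ∀ i → Coprime (toℕ (suc (2 * i) mod n)) n
  odd-coprime i {d} (d∣a%n , d∣n) = odd∧∣2^⇒1 (suc l) (λ 2∣d → 2∤1+2* i (∣-trans 2∣d d∣a)) d∣n
    where
    d∣a : d ∣ suc (2 * i)
    d∣a = ∣n∣m%n⇒∣m d∣n (subst (d ∣_) (toℕ-mod n (suc (2 * i))) d∣a%n)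

  even-not-coprime : ∀ i → ¬ Coprime (toℕ ((2 * i) mod n)) n
  even-not-coprime i co
    with co {2} (subst (2 ∣_) (sym (toℕ-mod n (2 * i))) (%-presˡ-∣ (m∣m*n i) (m∣m*n (2 ^ l))) , m∣m*n (2 ^ l))
  ... | ()

  scales-odd : scales n ↭ mapMaybe (residue-scale? n) (map (λ i → suc (2 * i)) (upTo (2 ^ l)))
  scales-odd = begin
    scales n                                        ≡⟨ scales-upTo n ⟩
    mapMaybe g (upTo (2 * 2 ^ l))                   ↭⟨ mapMaybe-↭ g (upTo-parity (2 ^ l)) ⟩
    mapMaybe g (evens ++ odds)                      ≡⟨ mapMaybe-++ g evens odds ⟩
    mapMaybe g evens ++ mapMaybe g odds             ≡⟨ cong (_++ mapMaybe g odds)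
      (mapMaybe-map-none {proj = g} {2 *_} (λ i → scale?-nothing n _ (even-not-coprime i)) (upTo (2 ^ l))) ⟩
    mapMaybe g odds                                 ∎
    where
    open PermutationReasoning
    g = residue-scale? n
    evens = map (2 *_) (upTo (2 ^ l))
    odds = map (λ i → suc (2 * i)) (upTo (2 ^ l))

  length-scales : length (scales n) ≡ 2 ^ l
  length-scales = begin
    length (scales n)          ≡⟨ ↭-length scales-odd ⟩
    length (mapMaybe g odds)   ≡⟨ cong length (mapMaybe-map g (λ i → suc (2 * i)) (upTo (2 ^ l))) ⟩
    length (mapMaybe (λ i → g (suc (2 * i))) (upTo (2 ^ l)))
      ≡⟨ length-mapMaybe-just _
           (λ i → let π , eq , _ = scale?-just n _ (odd-coprime i) in π , eq) (upTo (2 ^ l)) ⟩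
    length (upTo (2 ^ l))      ≡⟨ length-upTo (2 ^ l) ⟩
    2 ^ l                      ∎
    where
    open ≡-Reasoning
    g = residue-scale? n
    odds = map (λ i → suc (2 * i)) (upTo (2 ^ l))

  ∑-scales : sumOver (scales n) ctype ≋ sumOver (upTo (2 ^ l)) (λ i → residue-ctype n (suc (2 * i)))
  ∑-scales = ≋-trans (sumOver-↭ ctype scales-odd) (≋-reflexive
    (trans (sumOver-mapMaybe ctype (residue-scale? n) (map (λ i → suc (2 * i)) (upTo (2 ^ l))))
           (sumOver-map (residue-ctype n) (λ i → suc (2 * i)) (upTo (2 ^ l)))))

1/-cong : ∀ {j k} .{{_ : NonZero j}} .{{_ : NonZero k}} → j ≡ k → 1ℤ /ℚ j ≡ 1ℤ /ℚ k
1/-cong refl = refl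

module _ (r : ℕ) where

  private
    n = 2 ^ suc (suc r)
    instance
      n≢0 : NonZero n
      n≢0 = m^n≢0 2 (suc (suc r))
    G : ℕ → Poly
    G i = residue-ctype n (suc (2 * i))

    G-≋ : ∀ i {T} → All (0 <_) T → HasPeriods (suc (2 * i)) n (inflate T) → G i ≋ mono T
    G-≋ i = residue-ctype-≋ n (s≤s z≤n) (odd-coprime (suc r) i)

    exponent : ∀ s t → s + suc t ≡ r → suc t + suc (suc s) ≡ suc (suc r)
    exponent s t refl = arith s t
      where
      arith : ∀ s t → suc t + suc (suc s) ≡ suc (suc (s + suc t))
      arith = solve-∀

    remaining : ∀ s t → s + suc t ≡ r → suc s ≡ r ∸ t
    remaining s t refl = sym (trans (cong (_∸ t) (+-suc s t)) (m+n∸n≡m (suc s) t))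

  -- For each sign, the 2^t units with b of valuation s = r - 1 - t act as that sign modulo 2^(s+2).
  -- Hence k = s + 1 = r - t, and t + 1 doublings lead from 2^(k+1) to the modulus 2^(r+2).
  P⁺ P⁻ : ℕ → Poly
  P⁺ t = term (2 ^ t) (T⁺ (r ∸ t) (suc t))
  P⁻ t = term (2 ^ t) (T⁻ (r ∸ t) (suc t))

  ∑⁺ : sumOver (upTo (2 ^ r)) (λ b → G (2 * b)) ≋ mono (T⁺ (suc r) 0) +ₚ sumOver (upTo r) P⁺
  ∑⁺ = valuation-sum r (λ b → G (2 * b)) {T = λ t → T⁺ (r ∸ t) (suc t)}
    (G-≋ 0 (T⁺-positive (suc r) 0) (hasPeriods-1-T⁺ {k = suc r} refl))
    λ s t i eq → G-≋ (2 * (2 ^ s * suc (2 * i))) (T⁺-positive (r ∸ t) (suc t))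
      (subst₂ (λ e k → HasPeriods (suc (2 * (2 * (2 ^ s * suc (2 * i))))) (2 ^ e) (inflate (T⁺ k (suc t))))
        (exponent s t eq) (remaining s t eq)
        (hasPeriods-T⁺ {w = suc (2 * i)} (suc t) (s≤s z≤n) (2∤1+2* i)
          (cong suc (regroup (2 ^ s) (suc (2 * i))))))
    where
    regroup : ∀ p w → 2 * (2 * (p * w)) ≡ 2 * (2 * p) * w
    regroup p w = trans (cong (2 *_) (sym (*-assoc 2 p w))) (sym (*-assoc 2 (2 * p) w))

  -- The residues 3 + 4b with b < 2^r are read as -1 + 4c with c = b + 1, so that the exceptional c
  -- = 2^r is -1 itself. The index of -1 + 4c in `G` is 2c - 1, not truncated since c > 0.
  ∑⁻ : sumOver (upTo (2 ^ r)) (λ b → G (suc (2 * b))) ≋ mono (T⁻ (suc r) 0) +ₚ sumOver (upTo r) P⁻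
  ∑⁻ = ≋-trans
    (≋-reflexive (concatMap-cong (λ b → cong (λ c → G (pred c)) (sym (*-suc 2 b))) (upTo (2 ^ r))))
    (valuation-sum′ r (λ b → G (2 * b ∸ 1)) {T = λ t → T⁻ (r ∸ t) (suc t)}
      (G-≋ (2 * 2 ^ r ∸ 1) (T⁻-positive (suc r) 0)
        (hasPeriods-−1-T⁻ {k = suc r} {w = 1} (trans (1+[n∸1] (m^n>0 2 (suc r))) (sym (*-identityʳ (2 ^ suc r))))))
      λ s t i eq → G-≋ (2 * (2 ^ s * suc (2 * i)) ∸ 1) (T⁻-positive (r ∸ t) (suc t))
        (subst₂ (λ e k → HasPeriods (suc (2 * (2 * (2 ^ s * suc (2 * i)) ∸ 1))) (2 ^ e) (inflate (T⁻ k (suc t))))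
          (exponent s t eq) (remaining s t eq)
          (hasPeriods-T⁻ {w = suc (2 * i)}
            (trans (1+[n∸1] (*-mono-≤ (s≤s (z≤n {1})) (*-mono-≤ (m^n>0 2 s) (s≤s (z≤n {2 * i})))))
                   (sym (*-assoc 2 (2 ^ s) (suc (2 * i)))))
            (suc t) (s≤s z≤n) (2∤1+2* i))))
    where
    1+[n∸1] : ∀ {k} → 1 ≤ k → suc (k ∸ 1) ≡ k
    1+[n∸1] = m+[n∸m]≡n

  ∑-ctype : sumOver (scales n) ctype ≋
    (mono (T⁺ (suc r) 0) +ₚ sumOver (upTo r) P⁺) +ₚ (mono (T⁻ (suc r) 0) +ₚ sumOver (upTo r) P⁻)
  ∑-ctype = ≋-trans (∑-scales (suc r)) (≋-trans (sumOver-parity G (2 ^ r)) (+ₚ-cong ∑⁺ ∑⁻))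

  𝒵-≋ : 𝒵 (suc (suc r)) ≋ const (1/2^ (suc r)) *ₚ
    ((mono (T⁺ (suc r) 0) +ₚ sumOver (upTo r) P⁺) +ₚ (mono (T⁻ (suc r) 0) +ₚ sumOver (upTo r) P⁻))
  𝒵-≋ = ≋-trans (≋-reflexive (cong (λ c → const c *ₚ sumOver (scales n) ctype)
      (1/-cong {{PermutationGroup.order-nonZero (𝒰 n)}} {{m^n≢0 2 (suc r)}} (length-scales (suc r)))))
    (const-*-cong (1/2^ (suc r)) ∑-ctype)

-- Comparison with the closed form

↭⇒≋ : ∀ {p q : Poly} → p ↭ q → p ≋ q
↭⇒≋ {p} {q} r = subst₂ _≋_ (concatMap-pure p) (concatMap-pure q) (sumOver-↭ (λ t → t ∷ []) r)

sumOver-cong-upTo : ∀ {f g : ℕ → Poly} n → (∀ {t} → t < n → f t ≡ g t) →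
                    sumOver (upTo n) f ≡ sumOver (upTo n) g
sumOver-cong-upTo n eq = cong concat (map-cong-local (All.applyUpTo⁺₁ id n eq))

concatMap-applyUpTo : ∀ {A B : Set} (F : A → List B) g n →
                      concatMap F (applyUpTo g n) ≡ concatMap (F ∘ g) (upTo n)
concatMap-applyUpTo F g n = trans (cong (concatMap F) (sym (map-upTo g n))) (concatMap-map F g (upTo n))

mono-*-∑ : ∀ u (v : ℕ → Monomial) (k : ℕ → ℕ) ts →
           mono u *ₚ sumOver ts (λ t → term (k t) (v t)) ≡ sumOver ts (λ t → term (k t) (u ++ v t))
mono-*-∑ u v k [] = refl
mono-*-∑ u v k (t ∷ ts) = cong₂ _∷_ (cong (_, u ++ v t) (ℚ.*-identityˡ (ℤ.+ k t /ℚ 1))) (mono-*-∑ u v k ts)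

nat-*-x^-*-∏ : ∀ {A : Set} k i j (g h : A → ℕ) is →
  nat k *ₚ x i ^ₚ j *ₚ (∏[ l ∈ is ] x (g l) ^ₚ h l) ≡
  term k (replicate j i ++ concatMap (λ l → replicate (h l) (g l)) is)
nat-*-x^-*-∏ k i j g h is = begin
  nat k *ₚ x i ^ₚ j *ₚ (∏[ l ∈ is ] x (g l) ^ₚ h l)
    ≡⟨ cong₂ (λ p q → nat k *ₚ p *ₚ q) (x-^ i j) (∏-x-^ g h is) ⟩
  nat k *ₚ mono (replicate j i) *ₚ mono (concatMap (λ l → replicate (h l) (g l)) is)
    ≡⟨ cong (_*ₚ mono (concatMap (λ l → replicate (h l) (g l)) is)) (nat-*-mono k (replicate j i)) ⟩
  term k (replicate j i) *ₚ mono (concatMap (λ l → replicate (h l) (g l)) is)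
    ≡⟨ term-*-mono k (replicate j i) _ ⟩
  term k (replicate j i ++ concatMap (λ l → replicate (h l) (g l)) is) ∎
  where open ≡-Reasoning

module _ (p : ℕ) where

  private
    m = suc (suc (suc p))
    r = suc p
    p-p : r ∸ p ≡ 1
    p-p = m+n∸n≡m 1 p

  central : concatMap (λ l → replicate 2 (2 ^ (l ∸ 2))) [ 3 ⋯< m + 1 ] ≡ tower 1 r
  central = trans (concatMap-applyUpTo _ (3 +_) (p + 1)) (cong (tower 1) (+-comm p 1))

  first⁺ : x 1 ^ₚ (2 ^ m) ≡ mono (T⁺ (suc r) 0)
  first⁺ = trans (x-^ 1 (2 ^ m)) (cong mono (sym (++-identityʳ (replicate (2 ^ m) 1))))

  first⁻ : x 1 ^ₚ 2 *ₚ x 2 ^ₚ (2 ^ (m ∸ 1) ∸ 1) ≡ mono (T⁻ (suc r) 0)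
  first⁻ = trans (cong (x 1 ^ₚ 2 *ₚ_) (x-^ 2 (2 ^ (m ∸ 1) ∸ 1)))
    (cong (λ u → mono (1 ∷ 1 ∷ u)) (sym (++-identityʳ (replicate (2 ^ (m ∸ 1) ∸ 1) 2))))

  -- The summand t = m - 3 has b odd and k = 1, so its base modulus is 4: there 1 fixes four points,
  -- giving x_1^4, while -1 gives x_1^2 x_2.
  last⁺ : nat (2 ^ (m ∸ 3)) *ₚ x 1 ^ₚ 4 *ₚ (∏[ l ∈ [ 3 ⋯< m + 1 ] ] x (2 ^ (l ∸ 2)) ^ₚ 2) ≡ P⁺ r p
  last⁺ = trans (nat-*-x^-*-∏ (2 ^ p) 1 4 (λ l → 2 ^ (l ∸ 2)) (λ _ → 2) [ 3 ⋯< m + 1 ])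
    (cong (term (2 ^ p)) (trans (cong (replicate 4 1 ++_) central) (cong (λ k → T⁺ k r) (sym p-p))))

  last⁻ : nat (2 ^ (m ∸ 3)) *ₚ x 1 ^ₚ 2 *ₚ x 2 *ₚ (∏[ l ∈ [ 3 ⋯< m + 1 ] ] x (2 ^ (l ∸ 2)) ^ₚ 2) ≡ P⁻ r p
  last⁻ = begin
    nat (2 ^ p) *ₚ x 1 ^ₚ 2 *ₚ x 2 *ₚ (∏[ l ∈ [ 3 ⋯< m + 1 ] ] x (2 ^ (l ∸ 2)) ^ₚ 2)
      ≡⟨ cong₂ (λ q s → q *ₚ x 2 *ₚ s) (nat-*-mono (2 ^ p) (1 ∷ 1 ∷ []))
           (trans (∏-x-^ (λ l → 2 ^ (l ∸ 2)) (λ _ → 2) [ 3 ⋯< m + 1 ]) (cong mono central)) ⟩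
    term (2 ^ p) (1 ∷ 1 ∷ []) *ₚ mono (2 ∷ []) *ₚ mono (tower 1 r)
      ≡⟨ cong (_*ₚ mono (tower 1 r)) (term-*-mono (2 ^ p) (1 ∷ 1 ∷ []) (2 ∷ [])) ⟩
    term (2 ^ p) (1 ∷ 1 ∷ 2 ∷ []) *ₚ mono (tower 1 r)
      ≡⟨ term-*-mono (2 ^ p) (1 ∷ 1 ∷ 2 ∷ []) (tower 1 r) ⟩
    term (2 ^ p) (T⁻ 1 r)     ≡⟨ cong (λ k → term (2 ^ p) (T⁻ k r)) p-p ⟨
    P⁻ r p                    ∎
    where open ≡-Reasoning

  sum⁺ : (∑[ t ∈ [ 0 ⋯< m ∸ 3 ] ]
            nat (2 ^ t) *ₚ x 1 ^ₚ (2 ^ (m ∸ 1 ∸ t))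
              *ₚ (∏[ i ∈ [ 0 ⋯< t + 1 ] ] x (2 ^ (i + 1)) ^ₚ (2 ^ (m ∸ 2 ∸ t))))
         ≡ sumOver (upTo p) (P⁺ r)
  sum⁺ = sumOver-cong-upTo p λ {t} t<p → trans
    (nat-*-x^-*-∏ (2 ^ t) 1 (2 ^ (m ∸ 1 ∸ t)) (λ i → 2 ^ (i + 1)) (λ _ → 2 ^ (m ∸ 2 ∸ t)) [ 0 ⋯< t + 1 ])
    (cong (term (2 ^ t)) (cong₂ (λ k u → replicate (2 ^ k) 1 ++ u)
      (+-∸-assoc 1 (≤-trans (<⇒≤ t<p) (n≤1+n p)))
      (trans (concatMap-cong (λ i → cong (λ e → replicate (2 ^ (r ∸ t)) (2 ^ e)) (+-comm i 1)) (upTo (t + 1)))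
             (cong (tower (r ∸ t)) (+-comm t 1)))))

  -- In `T⁻` the variable x_2 has two sources: 2^k - 1 factors from the base modulus and 2^k from
  -- the lowest level of the tower, where k = m - 2 - t. The closed form merges them into
  -- x_2^(2^(k+1) - 1) and starts its product at i = 1.
  sum⁻ : x 1 ^ₚ 2 *ₚ
         (∑[ t ∈ [ 0 ⋯< m ∸ 3 ] ]
            nat (2 ^ t) *ₚ x 2 ^ₚ (2 ^ (m ∸ t ∸ 1) ∸ 1)
              *ₚ (∏[ i ∈ [ 1 ⋯< t + 1 ] ] x (2 ^ (i + 1)) ^ₚ (2 ^ (m ∸ t ∸ 2))))
         ≡ sumOver (upTo p) (P⁻ r)
  sum⁻ = trans (cong (x 1 ^ₚ 2 *ₚ_) (sumOver-cong-upTo p λ {t} t<p → trans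
      (nat-*-x^-*-∏ (2 ^ t) 2 (2 ^ (m ∸ t ∸ 1) ∸ 1) (λ i → 2 ^ (i + 1)) (λ _ → 2 ^ (m ∸ t ∸ 2)) [ 1 ⋯< t + 1 ])
      (cong (term (2 ^ t)) (twos {t} (+-∸-assoc 2 (≤-trans (<⇒≤ t<p) (n≤1+n p)))))))
    (mono-*-∑ (1 ∷ 1 ∷ []) (λ t → replicate (2 ^ (r ∸ t) ∸ 1) 2 ++ tower (r ∸ t) (suc t)) (2 ^_) (upTo p))
    where
    twos : ∀ {t k l} → l ≡ 2 + k →
      replicate (2 ^ (l ∸ 1) ∸ 1) 2 ++ concatMap (λ i → replicate (2 ^ (l ∸ 2)) (2 ^ (i + 1))) [ 1 ⋯< t + 1 ]
      ≡ replicate (2 ^ k ∸ 1) 2 ++ tower k (suc t)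
    twos {t} {k} refl = begin
      replicate (2 * 2 ^ k ∸ 1) 2 ++ concatMap F [ 1 ⋯< t + 1 ]
        ≡⟨ cong₂ (λ n u → replicate n 2 ++ u) split
             (trans (cong (concatMap F ∘ applyUpTo suc) (m+n∸n≡m t 1))
                    (concatMap-cong (λ i → cong (λ e → replicate (2 ^ k) (2 ^ e)) (+-comm i 1))
                                    (applyUpTo suc t))) ⟩
      replicate (2 ^ k ∸ 1 + 2 ^ k) 2 ++ rest   ≡⟨ cong (_++ rest) (replicate-+ (2 ^ k ∸ 1) (2 ^ k)) ⟩
      (replicate (2 ^ k ∸ 1) 2 ++ replicate (2 ^ k) 2) ++ rest
                                                ≡⟨ ++-assoc (replicate (2 ^ k ∸ 1) 2) _ rest ⟩
      replicate (2 ^ k ∸ 1) 2 ++ tower k (suc t) ∎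
      where
      open ≡-Reasoning
      F : ℕ → Monomial
      F i = replicate (2 ^ k) (2 ^ (i + 1))
      rest = concatMap (λ i → replicate (2 ^ k) (2 ^ suc i)) (applyUpTo suc t)
      split : 2 * 2 ^ k ∸ 1 ≡ 2 ^ k ∸ 1 + 2 ^ k
      split = trans (cong (λ n → 2 ^ k + n ∸ 1) (+-identityʳ (2 ^ k))) (+-∸-comm (2 ^ k) (m^n>0 2 k))

  𝒵-closed-form : 𝒵 m ≋ const (1/2^ (m ∸ 1)) *ₚ (𝒵₁ m +ₚ 𝒵₂ m)
  𝒵-closed-form = ≋-trans (𝒵-≋ r) (const-*-cong (1/2^ (suc r)) (begin
    (A⁺ +ₚ sumOver (upTo r) (P⁺ r)) +ₚ (A⁻ +ₚ sumOver (upTo r) (P⁻ r))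
      ≡⟨ cong₂ (λ q s → (A⁺ +ₚ q) +ₚ (A⁻ +ₚ s)) (sumOver-upTo-suc (P⁺ r) p) (sumOver-upTo-suc (P⁻ r) p) ⟩
    (A⁺ +ₚ (S⁺ +ₚ P⁺ r p)) +ₚ (A⁻ +ₚ (S⁻ +ₚ P⁻ r p))
      -- Polynomials are lists of terms, so the solver for `_++_` up to permutation applies. Of the
      -- six blocks, `c` and `f`, the summands with b odd, change sides.
      ≈⟨ ↭⇒≋ (solve 6 (λ a b c d e f → (a ⊕ (b ⊕ c)) ⊕ (d ⊕ (e ⊕ f)) ⊜ ((a ⊕ f) ⊕ b) ⊕ ((d ⊕ c) ⊕ e))
                ↭-refl A⁺ S⁺ (P⁺ r p) A⁻ S⁻ (P⁻ r p)) ⟩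
    (A⁺ +ₚ P⁻ r p +ₚ S⁺) +ₚ (A⁻ +ₚ P⁺ r p +ₚ S⁻)
      ≡⟨ cong₂ _+ₚ_ (cong₂ _+ₚ_ (cong₂ _+ₚ_ first⁺ last⁻) sum⁺) (cong₂ _+ₚ_ (cong₂ _+ₚ_ first⁻ last⁺) sum⁻) ⟨
    𝒵₁ m +ₚ 𝒵₂ m ∎))
    where
    open SetoidReasoning ≋-setoid
    open CommutativeMonoidSolver (++-commutativeMonoid)
    A⁺ = mono (T⁺ (suc r) 0)
    A⁻ = mono (T⁻ (suc r) 0)
    S⁺ = sumOver (upTo p) (P⁺ r)
    S⁻ = sumOver (upTo p) (P⁻ r)

lemma4p4 : (m : ℕ) → m ≥ 1 →
    (m ≡ 1 → 𝒵 m ≈ₚ x 1 ^ₚ 2)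
    × (m ≡ 2 → 𝒵 m ≈ₚ const ½ *ₚ (x 1 ^ₚ 4 +ₚ x 1 ^ₚ 2 *ₚ x 2))
    × (m ≥ 3 → 𝒵 m ≈ₚ const (1/2^ (m ∸ 1)) *ₚ (𝒵₁ m +ₚ 𝒵₂ m))
-- For m = 1 and m = 2 both sides evaluate to the same terms, so the coefficients agree by
-- computation.
lemma4p4 m _ = (λ { refl u → refl }) , (λ { refl u → refl }) ,
  λ { (s≤s (s≤s (s≤s {n = p} _))) → coeff-≡ (𝒵-closed-form p) }
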